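{- Let $T$ be a complete o-minimal theory in a language $\mathcal L$ extending the theory of ordered abelian groups, and assume that $T$ admits quantifier elimination and has a universal axiomatization. Let $\mathfrak f$ be a unary function symbol not in $\mathcal L$, let $T(\mathfrak f)$ be a complete theory in the language $\mathcal L(\mathfrak f)=\mathcal L\cup\{\mathfrak f\}$ extending $T$, and let $\mathbb M$ be a monster model of $T(\mathfrak f)$. Suppose that the following conditions hold. (i) The theory $T(\mathfrak f)$ has quantifier elimination. (ii) For every $(\mathcal A,\mathfrak f)\models T(\mathfrak f)$, every $\mathcal B\preceq\mathcal A$ (elementary substructure in the language $\mathcal L$) with $\mathfrak f(B)\subseteq B$ and every $c_1,\dots,c_n\in A$, there are $d_1,\dots,d_n\in A$ such that $$\mathfrak f\big(\mathcal B\langle c_1,\dots,c_n\rangle\big)\subseteq\langle\mathfrak f(B),d_1,\dots,d_n\rangle.$$ (iii) Whenever $f,g$ are $\mathcal L$-terms of arities $m+k$ and $n+l$ respectively, $(\vec a_i)_{i\in\omega}$ is an indiscernible sequence from $\mathbb M^m$, with $\vec a_i=(a_{i,1},\dots,a_{i,m})$, such that $n\le m$ and $a_{i,1},\dots,a_{i,n}\in\mathfrak f(\mathbb M)$ for every $i\in\omega$, $\vec b_1\in\mathbb M^k$ and $\vec b_2\in(\mathfrak f(\mathbb M))^l$, the set $$\big\{i\in\omega:\ \mathbb M\models\mathfrak f(f(\vec a_i,\vec b_1))=g(a_{i,1},\dots,a_{i,n},\vec b_2)\big\}$$ is finite or cofinite. Then $T(\mathfrak f)$ is dependent.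
   Context: For a model $\mathcal A$ of $T$ with underlying set $A$ and $X\subseteq A$, $\langle X\rangle$ denotes the $\mathcal L$-substructure of $\mathcal A$ generated by $X$ (since $T$ has quantifier elimination and a universal axiomatization, it is an elementary substructure of $\mathcal A$ and equals the $\mathcal L$-definable closure of $X$). For $\mathcal B\preceq\mathcal A$, $\mathcal B\langle X\rangle:=\langle B\cup X\rangle$; $\langle\mathfrak f(B),d_1,\dots,d_n\rangle$ means $\langle\mathfrak f(B)\cup\{d_1,\dots,d_n\}\rangle$. A model of $T(\mathfrak f)$ is written $(\mathcal A,\mathfrak f)$ with $\mathcal A$ its $\mathcal L$-reduct. A formula $\varphi(\vec x,\vec y)$ is dependent in a complete theory with monster model $\mathbb M$ (with $|\vec x|=p$, $|\vec y|=q$) if for every indiscernible sequence $(\vec a_i)_{i\in\omega}$ from $\mathbb M^p$ and every $\vec b\in\mathbb M^q$ there is $i_0\in\omega$ such that either $\mathbb M\models\varphi(\vec a_i,\vec b)$ for every $i>i_0$, or $\mathbb M\models\neg\varphi(\vec a_i,\vec b)$ for every $i>i_0$. The theory is dependent (has NIP) if every formula in its language is dependent in it. -}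

module Defs where

open import Level using (Level; Setω; suc)
open import Algebra.Structures using (IsAbelianGroup)
open import Axiom.ExcludedMiddle using (ExcludedMiddle)
open import Data.Empty.Polymorphic using (⊥)
open import Data.Fin.Base using (Fin)
open import Data.Irrelevant as Irrelevant using (Irrelevant)
open import Data.List.Base using (List)
open import Data.List.Relation.Unary.All using () renaming (All to Allᴸ)
open import Data.List.Relation.Unary.Any using () renaming (Any to Anyᴸ)
open import Data.Nat.Base as ℕ using (ℕ)
open import Data.Nat.InfinitelyOften using () renaming (Fin to Finite)
open import Data.Product.Base using (Σ; Σ-syntax; ∃-syntax; _×_; _,_)
open import Data.Refinement.Base using (Refinement-syntax; value; proof; _,_)
open import Data.Sum.Base using (_⊎_)
open import Data.Vec.Base as Vec using (Vec; []; _∷_; _++_; concat; lookup; map)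
open import Data.Vec.Relation.Unary.All using (All; []; _∷_)
open import Data.Vec.Relation.Unary.Linked using (Linked)
open import Function.Bundles using (_⇔_; _↣_; _⤖_; module Bijection)
open import Relation.Binary.Core using (Rel)
open import Relation.Binary.PropositionalEquality.Core using (_≡_)
open import Relation.Binary.Structures using (IsStrictTotalOrder)
open import Relation.Nullary.Construct.Add.Extrema using (_±; [_])
open import Relation.Nullary.Negation.Core using (¬_)
open import Relation.Unary using (Pred; _∈_; ∁)
import Relation.Binary.Construct.Add.Extrema.Strict as ExtremaStrict

private
  variable
    ℓ : Level

-- The model theory below is classical.  Since Dec is not truncated, this
-- hypothesis also yields choice (from ¬ ¬ A one obtains an element of A),
-- so it stands in for the whole classical metatheory.
Classical : Setω
Classical = ∀ {a} → ExcludedMiddle a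

record Language (ℓ : Level) : Set (suc ℓ) where
  field
    Func : ℕ → Set ℓ
    Rela : ℕ → Set ℓ

open Language public

data Term (L : Language ℓ) (n : ℕ) : Set ℓ where
  var : Fin n → Term L n
  app : ∀ {k} → Func L k → Vec (Term L n) k → Term L n

infix  6 _≐_
infixr 5 _⇒_

-- Formulas with free variables among n de Bruijn indices; ∀̇ binds index 0.
-- The remaining connectives are the classical abbreviations.
data Formula (L : Language ℓ) : ℕ → Set ℓ where
  _≐_ : ∀ {n} → Term L n → Term L n → Formula L n
  rel : ∀ {n k} → Rela L k → Vec (Term L n) k → Formula L n
  ⊥̇   : ∀ {n} → Formula L n
  _⇒_ : ∀ {n} → Formula L n → Formula L n → Formula L n
  ∀̇_  : ∀ {n} → Formula L (ℕ.suc n) → Formula L n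

¬̇_ : ∀ {L : Language ℓ} {n} → Formula L n → Formula L n
¬̇ φ = φ ⇒ ⊥̇

Sentence : Language ℓ → Set ℓ
Sentence L = Formula L 0

-- Any set of sentences, not necessarily deductively closed; accordingly,
-- extension of theories is expressed below through models.
Theory : Language ℓ → Set (suc ℓ)
Theory {ℓ} L = Pred (Sentence L) ℓ

-- Nonemptiness is not imposed: every language considered has a constant.
record Structure (L : Language ℓ) : Set (suc ℓ) where
  field
    Carrier : Set ℓ
    fun     : ∀ {k} → Func L k → Vec Carrier k → Carrier
    rela    : ∀ {k} → Rela L k → Vec Carrier k → Set ℓ

open Structure public

module _ {L : Language ℓ} (A : Structure L) where

  eval  : ∀ {n} → Vec (Carrier A) n → Term L n → Carrier A
  evals : ∀ {n k} → Vec (Carrier A) n → Vec (Term L n) k → Vec (Carrier A) k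
  eval v (var i)    = lookup v i
  eval v (app F ts) = fun A F (evals v ts)
  evals v []        = []
  evals v (t ∷ ts)  = eval v t ∷ evals v ts

infix 4 _⊨_[_]

_⊨_[_] : ∀ {L : Language ℓ} (A : Structure L) {n} → Formula L n → Vec (Carrier A) n → Set ℓ
A ⊨ s ≐ t    [ v ] = eval A v s ≡ eval A v t
A ⊨ rel R ts [ v ] = rela A R (evals A v ts)
A ⊨ ⊥̇        [ v ] = ⊥
A ⊨ φ ⇒ ψ    [ v ] = A ⊨ φ [ v ] → A ⊨ ψ [ v ]
A ⊨ ∀̇ φ      [ v ] = ∀ x → A ⊨ φ [ x ∷ v ]

module _ {L : Language ℓ} where

  infix 4 _isModelOf_ _entails_

  _isModelOf_ : Structure L → Theory L → Set ℓ
  A isModelOf T = ∀ σ → T σ → A ⊨ σ [ [] ]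

  _entails_ : Theory L → Sentence L → Set (suc ℓ)
  T entails σ = ∀ A → A isModelOf T → A ⊨ σ [ [] ]

  IsComplete : Theory L → Set (suc ℓ)
  IsComplete T = ¬ (T entails ⊥̇) × (∀ σ → T entails σ ⊎ T entails (¬̇ σ))

  data QuantifierFree {n} : Formula L n → Set ℓ where
    _≐_ : ∀ s t → QuantifierFree (s ≐ t)
    rel : ∀ {k} (R : Rela L k) ts → QuantifierFree (rel R ts)
    ⊥̇   : QuantifierFree ⊥̇
    _⇒_ : ∀ {φ ψ} → QuantifierFree φ → QuantifierFree ψ → QuantifierFree (φ ⇒ ψ)

  data Universal {n} : Formula L n → Set ℓ where
    qf  : ∀ {φ} → QuantifierFree φ → Universal φ
    ∀̇_  : ∀ {φ} → Universal φ → Universal (∀̇ φ)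

  HasQE : Theory L → Set (suc ℓ)
  HasQE T = ∀ {n} (φ : Formula L n) →
    ∃[ ψ ] QuantifierFree ψ ×
      (∀ A → A isModelOf T → ∀ v → A ⊨ φ [ v ] ⇔ A ⊨ ψ [ v ])

  HasUniversalAxiomatization : Theory L → Set (suc ℓ)
  HasUniversalAxiomatization T =
    Σ[ U ∈ Theory L ] (∀ σ → U σ → Universal σ) ×
      (∀ A → A isModelOf T ⇔ A isModelOf U)

-- No symbol for negation is required, only that negatives exist, so this
-- covers both common choices of the language of ordered abelian groups.
record HasOrderedGroupSymbols (L : Language ℓ) : Set ℓ where
  field
    0ˢ : Func L 0
    +ˢ : Func L 2
    <ˢ : Rela L 2

module _ {L : Language ℓ} (S : HasOrderedGroupSymbols L) where
  open HasOrderedGroupSymbols S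

  less : (A : Structure L) → Rel (Carrier A) ℓ
  less A x y = rela A <ˢ (x ∷ y ∷ [])

  record IsOrderedAbelianGroup (A : Structure L) : Set ℓ where
    infixl 6 _+_
    _+_ : Carrier A → Carrier A → Carrier A
    x + y = fun A +ˢ (x ∷ y ∷ [])
    0# : Carrier A
    0# = fun A 0ˢ []
    field
      -_                 : Carrier A → Carrier A
      isAbelianGroup     : IsAbelianGroup _≡_ _+_ 0# -_
      isStrictTotalOrder : IsStrictTotalOrder _≡_ (less A)
      +-monoʳ-<          : ∀ x {y z} → less A y z → less A (x + y) (x + z)

  ExtendsOrderedAbelianGroups : Theory L → Set (suc ℓ)
  ExtendsOrderedAbelianGroups T = ∀ A → A isModelOf T → IsOrderedAbelianGroup A

  data Piece (A : Structure L) : Set ℓ where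
    point    : Carrier A → Piece A
    interval : (l u : Carrier A ±) → Piece A

  _∈ₚ_ : ∀ {A} → Carrier A → Piece A → Set ℓ
  _∈ₚ_     x (point a)      = x ≡ a
  _∈ₚ_ {A} x (interval l u) = (l <± [ x ]) × ([ x ] <± u)
    where open ExtremaStrict (less A) using (_<±_)

  IsOMinimal : Structure L → Set ℓ
  IsOMinimal A = ∀ {n} (φ : Formula L (ℕ.suc n)) (v : Vec (Carrier A) n) →
    Σ[ ps ∈ List (Piece A) ] (∀ x → A ⊨ φ [ x ∷ v ] ⇔ Anyᴸ (x ∈ₚ_) ps)

  IsOMinimalTheory : Theory L → Set (suc ℓ)
  IsOMinimalTheory T = ∀ A → A isModelOf T → IsOMinimal A

module _ {L : Language ℓ} (A : Structure L) where

  data ⟨_⟩ (X : Pred (Carrier A) ℓ) : Pred (Carrier A) ℓ where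
    gen : ∀ {x} → X x → ⟨ X ⟩ x
    app : ∀ {k} (F : Func L k) {v} → All ⟨ X ⟩ v → ⟨ X ⟩ (fun A F v)

  IsClosed : Pred (Carrier A) ℓ → Set ℓ
  IsClosed B = ∀ {k} (F : Func L k) {v} → All B v → B (fun A F v)

  -- Membership proofs are irrelevant, so two elements of the substructure
  -- are equal exactly when they are equal in A.
  substructure : (B : Pred (Carrier A) ℓ) → IsClosed B → Structure L
  substructure B closed = record
    { Carrier = [ x ∈ Carrier A ∣ B x ]
    ; fun     = λ F v → fun A F (map value v) , Irrelevant.map (closed F) (proofs v)
    ; rela    = λ R v → rela A R (map value v)
    }
    where
    proofs : ∀ {k} (v : Vec [ x ∈ Carrier A ∣ B x ] k) → Irrelevant (All B (map value v))
    proofs []      = Irrelevant.pure []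
    proofs (x ∷ v) = Irrelevant.zipWith _∷_ (proof x) (proofs v)

  record IsElementarySubstructure (B : Pred (Carrier A) ℓ) : Set ℓ where
    field
      closed     : IsClosed B
      elementary : ∀ {n} (φ : Formula L n) v →
        substructure B closed ⊨ φ [ v ] ⇔ A ⊨ φ [ map value v ]

data Func⁺ (L : Language ℓ) : ℕ → Set ℓ where
  old : ∀ {k} → Func L k → Func⁺ L k
  𝔣   : Func⁺ L 1

_⟨𝔣⟩ : Language ℓ → Language ℓ
L ⟨𝔣⟩ = record { Func = Func⁺ L ; Rela = Rela L }

module _ {L : Language ℓ} where

  reduct : Structure (L ⟨𝔣⟩) → Structure L
  reduct A = record
    { Carrier = Carrier A
    ; fun     = λ F → fun A (old F)
    ; rela    = rela A
    }

  𝔣⟦_⟧ : (A : Structure (L ⟨𝔣⟩)) → Carrier A → Carrier A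
  𝔣⟦ A ⟧ x = fun A 𝔣 (x ∷ [])

  Extends : Theory (L ⟨𝔣⟩) → Theory L → Set (suc ℓ)
  Extends T𝔣 T = ∀ A → A isModelOf T𝔣 → reduct A isModelOf T

image : ∀ {X Y : Set ℓ} → (X → Y) → Pred X ℓ → Pred Y ℓ
image f S y = ∃[ x ] x ∈ S × f x ≡ y

range : ∀ {X Y : Set ℓ} → (X → Y) → Pred Y ℓ
range f y = ∃[ x ] f x ≡ y

infix 4 _≺_

_≺_ : ∀ {a b} → Set a → Set b → Set _
X ≺ Y = (X ↣ Y) × ¬ (Y ↣ X)

-- At least countable, so that X ≺ κ below means |L| < κ with |L| ≥ ℵ₀.
Symbols : Language ℓ → Set ℓ
Symbols L = ℕ ⊎ (Σ[ k ∈ ℕ ] Func L k) ⊎ (Σ[ k ∈ ℕ ] Rela L k)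

module _ {L : Language ℓ} (M : Structure L) where

  -- Small parameter sets are given as families a : I → M with |I| < κ.
  -- A pair (φ , w) stands for the formula φ(x, a_w) over the parameters a.
  IsSaturated : Set ℓ → Set (suc ℓ)
  IsSaturated κ = ∀ (I : Set ℓ) (a : I → Carrier M) → I ≺ κ →
    let Formulaₐ : Set ℓ
        Formulaₐ = Σ[ n ∈ ℕ ] Formula L (ℕ.suc n) × Vec I n
        Sat : Carrier M → Formulaₐ → Set ℓ
        Sat = λ { x (n , φ , w) → M ⊨ φ [ x ∷ map a w ] }
    in (p : Pred Formulaₐ ℓ) →
       (∀ Φ → Allᴸ p Φ → ∃[ x ] Allᴸ (Sat x) Φ) →
       ∃[ x ] (∀ χ → p χ → Sat x χ)

  record IsAutomorphism (σ : Carrier M ⤖ Carrier M) : Set ℓ where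
    open Bijection σ using (to)
    field
      fun-homo  : ∀ {k} (F : Func L k) v → to (fun M F v) ≡ fun M F (map to v)
      rela-homo : ∀ {k} (R : Rela L k) v → rela M R v ⇔ rela M R (map to v)

  -- The partial elementary maps with small domain are a i ↦ b i.
  IsStronglyHomogeneous : Set ℓ → Set (suc ℓ)
  IsStronglyHomogeneous κ = ∀ (I : Set ℓ) (a b : I → Carrier M) → I ≺ κ →
    (∀ {n} (φ : Formula L n) w → M ⊨ φ [ map a w ] ⇔ M ⊨ φ [ map b w ]) →
    Σ[ σ ∈ Carrier M ⤖ Carrier M ] IsAutomorphism σ × (∀ i → Bijection.to σ (a i) ≡ b i)

  -- a₀, a₁, … is indiscernible over ∅.
  IsIndiscernible : ∀ {p} → (ℕ → Vec (Carrier M) p) → Set ℓ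
  IsIndiscernible {p} a = ∀ {k} (φ : Formula L (k ℕ.* p)) (is js : Vec ℕ k) →
    Linked ℕ._<_ is → Linked ℕ._<_ js →
    M ⊨ φ [ concat (map a is) ] ⇔ M ⊨ φ [ concat (map a js) ]

record IsMonsterModel {L : Language ℓ} (T : Theory L) (M : Structure L) : Set (suc ℓ) where
  field
    isModel             : M isModelOf T
    κ                   : Set ℓ
    κ-large             : Symbols L ≺ κ
    saturated           : IsSaturated M κ
    stronglyHomogeneous : IsStronglyHomogeneous M κ

module _ {L : Language ℓ} (M : Structure L) where

  -- The variables of φ are split as (x⃗ , y⃗) with |x⃗| = p and |y⃗| = q.
  IsDependentFormula : ∀ p q → Formula L (p ℕ.+ q) → Set ℓ
  IsDependentFormula p q φ =
    ∀ (a : ℕ → Vec (Carrier M) p) → IsIndiscernible M a →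
    ∀ (b : Vec (Carrier M) q) →
    ∃[ i₀ ] ((∀ i → i ℕ.> i₀ → M ⊨ φ [ a i ++ b ])
           ⊎ (∀ i → i ℕ.> i₀ → M ⊨ ¬̇ φ [ a i ++ b ]))

  -- Dependence of a complete theory, tested in its monster model M.
  IsDependent : Set ℓ
  IsDependent = ∀ {p q} (φ : Formula L (p ℕ.+ q)) → IsDependentFormula p q φ

-- Finite subsets of ℕ, as in the library, are those with an upper bound.
FiniteOrCofinite : Pred ℕ ℓ → Set ℓ
FiniteOrCofinite S = Finite S ⊎ Finite (∁ S)

-- The idea is to rewrite 𝔣(t(aᵢ, b)), for t an L-term and (aᵢ) indiscernible,
-- as an L-term in an indiscernible sequence and constants, for almost all i.
-- This removes the occurrences of 𝔣 from a quantifier-free formula one at a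
-- time, and L-formulas are dependent by o-minimality.
--
-- Suppose that for no finite tuple e over which (aᵢ) is indiscernible, no d in
-- the range of 𝔣 and no terms g, h does 𝔣(t(aᵢ, b)) = g(𝔣(h(aᵢ, e)), d) hold
-- infinitely often.  Let B be generated by all aᵢ and e, and let x realise
-- every formula over B, b and d that holds at almost all aᵢ.  Then (aᵢ) is
-- still indiscernible over e and x, and 𝔣(t(x, b)) is not in the L-substructure
-- generated by d and the image under 𝔣 of B⟨x⟩, while d stays independent over
-- that image.  Iterating, one gets |b| + 1 elements of 𝔣(B⟨b⟩) that are
-- independent over 𝔣(B), which contradicts (ii), since L-generation has the
-- exchange property.  So some equation of this kind holds infinitely often,
-- hence almost always by (iii).
module Submission where

open import Defs
open import Level using (Level; Lift; lift; _⊔_) renaming (suc to lsuc)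
open import Data.Fin.Base as Fin using (Fin; zero; suc)
open import Data.Fin.Properties using (toℕ-injective; toℕ<n)
open import Data.Irrelevant as Irrelevant using ()
open import Data.List.Base as List using (List; []; _∷_)
open import Data.List.Relation.Unary.All using ([]; _∷_) renaming (All to Allᴸ)
open import Data.List.Relation.Unary.Any using (here; there) renaming (Any to Anyᴸ)
open import Data.Maybe.Base using (Maybe; just; nothing; maybe′)
open import Data.Nat.Base as ℕ using (ℕ; zero; suc; _+_; _*_)
import Data.Nat.Properties as ℕ
open import Data.Product.Base using (Σ-syntax; ∃; ∃-syntax; _×_; _,_; proj₁; proj₂)
open import Data.Refinement.Base using (value; _,_)
open import Data.Sum.Base using (_⊎_; inj₁; inj₂; [_,_]′)
open import Data.Unit.Polymorphic using (⊤; tt)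
open import Data.Vec.Base as Vec
  using (Vec; []; _∷_; _++_; concat; drop; head; lookup; map; tabulate; tail; take; truncate)
open import Data.Vec.Membership.Propositional using () renaming (_∈_ to _∈ᵛ_)
open import Data.Vec.Membership.Propositional.Properties using (∈-lookup; ∈-++⁺ˡ; ∈-++⁺ʳ)
open import Data.Vec.Properties
  using (++-injective; lookup-map; map-++; map-cong; map-∘; tabulate-∘; tabulate∘lookup; take++drop≡id)
open import Data.Vec.Relation.Unary.All as All using (All; []; _∷_)
import Data.Vec.Relation.Unary.All.Properties as All
open import Data.Vec.Relation.Unary.Any as Any using (here; there)
import Data.Vec.Relation.Unary.Any.Properties as Any
open import Data.Vec.Relation.Unary.Linked using (Linked; []; [-]; _∷_)
open import Function.Base using (_∘_; id; case_of_; flip)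
open import Function.Bundles using (_⇔_; mk⇔; _↣_; mk↣; module Equivalence; module Injection)
open import Function.Construct.Composition using (_↣-∘_)
import Function.Properties.Equivalence as ⇔
import Relation.Binary.Construct.Add.Extrema.Strict as ExtremaStrict
import Relation.Binary.Construct.Add.Supremum.Strict as Supremum
import Relation.Binary.Construct.StrictToNonStrict as NonStrict
open import Relation.Binary.Definitions using (tri<; tri≈; tri>)
open import Relation.Binary.PropositionalEquality using (_≡_; refl; sym; trans; cong; cong₂; subst)
open import Relation.Binary.Structures using (IsStrictTotalOrder; IsTotalOrder)
open import Relation.Nullary using (¬_; Dec; yes; no; contradiction)
open import Relation.Nullary.Construct.Add.Extrema using ([_]; ⊥±; ⊤±)
open import Relation.Nullary.Negation.Core using (contradiction-irr)
open import Relation.Unary using (Pred; _⊆_; _∪_)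

open Equivalence using (to; from)

-- Three obstacles shape the construction. The sequence (aᵢ) need not be indiscernible over b, so e
-- collects only limits of (aᵢ), and b enters solely through values such as 𝔣(t(x, b)). An equation
-- may mention many earlier aᵢ; finitely many occur, so they are turned into constants and the
-- sequence is restarted behind them. Finally, (ii) asks for a set closed under 𝔣, so B is generated
-- in the language with 𝔣 and the terms h may nest 𝔣; (iii) still applies because the values 𝔣(h(aᵢ,
-- y)) are put in front of aᵢ as further coordinates of an indiscernible sequence.
--
-- Both uses of o-minimality count alternations: a definable subset of the line is cut into finitely
-- many convex runs, numbered from below and definable from the same parameters. For exchange, the
-- run containing b is defined without naming b. For dependence, having alternated j times is an
-- upwards closed condition, so that indiscernibility decides it; a bound on j valid along the whole
-- sequence is read off at a limit tuple.

private variable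
  ℓ ℓ₁ ℓ₂ ℓ₃ : Level
  m n k l : ℕ

-- Substitution of terms.

module _ {L : Language ℓ} where

  infixl 8 _⟪_⟫ _⟪_⟫*

  _⟪_⟫  : Term L n → Vec (Term L m) n → Term L m
  _⟪_⟫* : Vec (Term L n) k → Vec (Term L m) n → Vec (Term L m) k
  var i    ⟪ us ⟫ = lookup us i
  app F ts ⟪ us ⟫ = app F (ts ⟪ us ⟫*)
  []       ⟪ us ⟫* = []
  (t ∷ ts) ⟪ us ⟫* = t ⟪ us ⟫ ∷ ts ⟪ us ⟫*

  lifted : Vec (Term L m) n → Vec (Term L (suc m)) (suc n)
  lifted us = var zero ∷ us ⟪ tabulate (var ∘ suc) ⟫*

  substitute : Formula L n → Vec (Term L m) n → Formula L m
  substitute (s ≐ t)    us = s ⟪ us ⟫ ≐ t ⟪ us ⟫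
  substitute (rel R ts) us = rel R (ts ⟪ us ⟫*)
  substitute ⊥̇          us = ⊥̇
  substitute (φ ⇒ ψ)    us = substitute φ us ⇒ substitute ψ us
  substitute (∀̇ φ)      us = ∀̇ substitute φ (lifted us)

  module _ (A : Structure L) where

    evals≡map : (v : Vec (Carrier A) n) (ts : Vec (Term L n) k) → evals A v ts ≡ map (eval A v) ts
    evals≡map v []       = refl
    evals≡map v (t ∷ ts) = cong (eval A v t ∷_) (evals≡map v ts)

    eval-⟪⟫   : (v : Vec (Carrier A) m) (us : Vec (Term L m) n) (t : Term L n) →
                eval A v (t ⟪ us ⟫) ≡ eval A (evals A v us) t
    evals-⟪⟫* : (v : Vec (Carrier A) m) (us : Vec (Term L m) n) (ts : Vec (Term L n) k) →
                evals A v (ts ⟪ us ⟫*) ≡ evals A (evals A v us) ts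
    eval-⟪⟫ v us (var i) rewrite evals≡map v us = sym (lookup-map i (eval A v) us)
    eval-⟪⟫ v us (app F ts) = cong (fun A F) (evals-⟪⟫* v us ts)
    evals-⟪⟫* v us []       = refl
    evals-⟪⟫* v us (t ∷ ts) = cong₂ _∷_ (eval-⟪⟫ v us t) (evals-⟪⟫* v us ts)

    evals-vars : (v : Vec (Carrier A) m) (f : Fin n → Fin m) →
                 evals A v (tabulate (var ∘ f)) ≡ tabulate (lookup v ∘ f)
    evals-vars v f = trans (evals≡map v _) (sym (tabulate-∘ (eval A v) (var ∘ f)))

    evals-lifted : ∀ x (v : Vec (Carrier A) m) (us : Vec (Term L m) n) →
                   evals A (x ∷ v) (lifted us) ≡ x ∷ evals A v us
    evals-lifted x v us = cong (x ∷_) (trans (evals-⟪⟫* (x ∷ v) _ us)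
      (cong (λ w → evals A w us) (trans (evals-vars (x ∷ v) suc) (tabulate∘lookup v))))

    ⊨-substitute : (φ : Formula L n) (us : Vec (Term L m) n) (v : Vec (Carrier A) m) →
                   A ⊨ substitute φ us [ v ] ⇔ A ⊨ φ [ evals A v us ]
    ⊨-substitute (s ≐ t) us v rewrite eval-⟪⟫ v us s | eval-⟪⟫ v us t = ⇔.refl
    ⊨-substitute (rel R ts) us v rewrite evals-⟪⟫* v us ts = ⇔.refl
    ⊨-substitute ⊥̇ us v = ⇔.refl
    ⊨-substitute (φ ⇒ ψ) us v =
      mk⇔ (λ h x → to ψ⇔ (h (from φ⇔ x))) (λ h x → from ψ⇔ (h (to φ⇔ x)))
      where
      φ⇔ = ⊨-substitute φ us v
      ψ⇔ = ⊨-substitute ψ us v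
    ⊨-substitute (∀̇ φ) us v = mk⇔
      (λ h x → subst (A ⊨ φ [_]) (evals-lifted x v us) (to (φ⇔ x) (h x)))
      (λ h x → from (φ⇔ x) (subst (A ⊨ φ [_]) (sym (evals-lifted x v us)) (h x)))
      where φ⇔ = λ x → ⊨-substitute φ (lifted us) (x ∷ v)

-- A calculus of definable functions and predicates.

-- Definability is measured against a family κ of tuples indexed by an
-- arbitrary type E: only the elements κ e may be used to define f e or P e.
module _ {L : Language ℓ} (A : Structure L) where

  record TermFun {E : Set ℓ₁} (κ : E → Vec (Carrier A) n) (f : E → Carrier A) : Set (ℓ ⊔ ℓ₁) where
    constructor _,_
    field
      term      : Term L n
      eval-term : ∀ x → eval A (κ x) term ≡ f x

  record TermFuns {E : Set ℓ₁} (κ : E → Vec (Carrier A) n) (f : E → Vec (Carrier A) k) : Set (ℓ ⊔ ℓ₁) where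
    constructor _,_
    field
      terms       : Vec (Term L n) k
      evals-terms : ∀ x → evals A (κ x) terms ≡ f x

  record Definable {E : Set ℓ₁} (κ : E → Vec (Carrier A) n) (P : E → Set ℓ₂) : Set (ℓ ⊔ ℓ₁ ⊔ ℓ₂) where
    constructor _,_
    field
      formula   : Formula L n
      ⊨-formula : ∀ x → A ⊨ formula [ κ x ] ⇔ P x

open TermFun public
open TermFuns public
open Definable public

module _ {L : Language ℓ} {A : Structure L} where

  private variable
    E E′ : Set ℓ₁
    κ κ′ : E → Vec (Carrier A) n

  idᵀ : TermFuns A κ κ
  idᵀ {κ = κ} = tabulate var , λ x → trans (evals-vars A (κ x) id) (tabulate∘lookup (κ x))

  []ᵀ : TermFuns A κ (λ _ → [])
  []ᵀ = [] , λ _ → refl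

  infixr 5 _∷ᵀ_ _++ᵀ_

  _∷ᵀ_ : {f : E → Carrier A} {g : E → Vec (Carrier A) k} →
         TermFun A κ f → TermFuns A κ g → TermFuns A κ (λ x → f x ∷ g x)
  (t , t≡) ∷ᵀ (ts , ts≡) = t ∷ ts , λ x → cong₂ _∷_ (t≡ x) (ts≡ x)

  evals-++ : (v : Vec (Carrier A) n) (ts : Vec (Term L n) k) (us : Vec (Term L n) l) →
             evals A v (ts ++ us) ≡ evals A v ts ++ evals A v us
  evals-++ v []       us = refl
  evals-++ v (t ∷ ts) us = cong (eval A v t ∷_) (evals-++ v ts us)

  _++ᵀ_ : {f : E → Vec (Carrier A) k} {g : E → Vec (Carrier A) l} →
          TermFuns A κ f → TermFuns A κ g → TermFuns A κ (λ x → f x ++ g x)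
  _++ᵀ_ {κ = κ} (ts , ts≡) (us , us≡) =
    ts ++ us , λ x → trans (evals-++ (κ x) ts us) (cong₂ _++_ (ts≡ x) (us≡ x))

  private
    split : ∀ k {f : E → Vec (Carrier A) k} {g : E → Vec (Carrier A) l} →
            TermFuns A κ (λ x → f x ++ g x) → TermFuns A κ f × TermFuns A κ g
    split {κ = κ} k {f} {g} (ts , ts≡) =
      (take k ts , λ x → proj₁ (both x)) , (drop k ts , λ x → proj₂ (both x))
      where
      both : ∀ x → evals A (κ x) (take k ts) ≡ f x × evals A (κ x) (drop k ts) ≡ g x
      both x = ++-injective _ (f x) (trans (sym (evals-++ (κ x) (take k ts) (drop k ts)))
        (trans (cong (evals A (κ x)) (take++drop≡id k ts)) (ts≡ x)))

  ++⁻ˡ : ∀ k {f : E → Vec (Carrier A) k} {g : E → Vec (Carrier A) l} →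
         TermFuns A κ (λ x → f x ++ g x) → TermFuns A κ f
  ++⁻ˡ k f++g = proj₁ (split k f++g)

  ++⁻ʳ : ∀ k {f : E → Vec (Carrier A) k} {g : E → Vec (Carrier A) l} →
         TermFuns A κ (λ x → f x ++ g x) → TermFuns A κ g
  ++⁻ʳ k f++g = proj₂ (split k f++g)

  headᵀ : {f : E → Vec (Carrier A) (suc k)} → TermFuns A κ f → TermFun A κ (head ∘ f)
  headᵀ (t ∷ ts , ts≡) = t , λ x → cong head (ts≡ x)

  tailᵀ : {f : E → Vec (Carrier A) (suc k)} → TermFuns A κ f → TermFuns A κ (tail ∘ f)
  tailᵀ (t ∷ ts , ts≡) = ts , λ x → cong tail (ts≡ x)

  infixl 8 _∘ᵀ_ _∘ᵀˢ_ _∘ᴰ_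

  _∘ᵀ_ : {g : E′ → E} {f : E → Carrier A} →
         TermFun A κ f → TermFuns A κ′ (κ ∘ g) → TermFun A κ′ (f ∘ g)
  _∘ᵀ_ {κ′ = κ′} {g = g} (t , t≡) (us , us≡) = t ⟪ us ⟫ , λ x →
    trans (eval-⟪⟫ A (κ′ x) us t) (trans (cong (λ w → eval A w t) (us≡ x)) (t≡ (g x)))

  _∘ᵀˢ_ : {g : E′ → E} {f : E → Vec (Carrier A) k} →
          TermFuns A κ f → TermFuns A κ′ (κ ∘ g) → TermFuns A κ′ (f ∘ g)
  _∘ᵀˢ_ {κ′ = κ′} {g = g} (ts , ts≡) (us , us≡) = ts ⟪ us ⟫* , λ x →
    trans (evals-⟪⟫* A (κ′ x) us ts) (trans (cong (λ w → evals A w ts) (us≡ x)) (ts≡ (g x)))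

  -- Change of variables: it suffices that terms recover the old coordinates from the new ones. All
  -- later rearrangements of de Bruijn indices are instances.
  _∘ᴰ_ : {g : E′ → E} {P : E → Set ℓ₂} →
         Definable A κ P → TermFuns A κ′ (κ ∘ g) → Definable A κ′ (P ∘ g)
  _∘ᴰ_ {κ′ = κ′} {g = g} (φ , φ⇔) (us , us≡) = substitute φ us , λ x →
    ⇔.trans (⊨-substitute A φ us (κ′ x))
      (subst (λ w → A ⊨ φ [ w ] ⇔ _) (sym (us≡ x)) (φ⇔ (g x)))

  evalᵀ : (t : Term L k) {f : E → Vec (Carrier A) k} → TermFuns A κ f →
          TermFun A κ (λ x → eval A (f x) t)
  evalᵀ t fᵀ = _∘ᵀ_ {κ = id} (t , λ _ → refl) fᵀ

  evalsᵀ : (ts : Vec (Term L k) l) {f : E → Vec (Carrier A) k} → TermFuns A κ f →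
           TermFuns A κ (λ x → evals A (f x) ts)
  evalsᵀ ts fᵀ = _∘ᵀˢ_ {κ = id} (ts , λ _ → refl) fᵀ

  funᵀ : (F : Func L k) {f : E → Vec (Carrier A) k} → TermFuns A κ f → TermFun A κ (fun A F ∘ f)
  funᵀ F (ts , ts≡) = app F ts , λ x → cong (fun A F) (ts≡ x)

  ⊨ᴰ : (φ : Formula L k) {f : E → Vec (Carrier A) k} → TermFuns A κ f →
       Definable A κ (λ x → A ⊨ φ [ f x ])
  ⊨ᴰ φ fᵀ = _∘ᴰ_ {κ = id} (φ , λ _ → ⇔.refl) fᵀ

  relᴰ : (R : Rela L k) {f : E → Vec (Carrier A) k} → TermFuns A κ f →
         Definable A κ (rela A R ∘ f)
  relᴰ R (ts , ts≡) = rel R ts , λ x → subst (λ w → rela A R w ⇔ _) (sym (ts≡ x)) ⇔.refl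

  _≡ᴰ_ : {f g : E → Carrier A} → TermFun A κ f → TermFun A κ g → Definable A κ (λ x → f x ≡ g x)
  (s , s≡) ≡ᴰ (t , t≡) = s ≐ t , λ x →
    mk⇔ (λ h → trans (sym (s≡ x)) (trans h (t≡ x))) (λ h → trans (s≡ x) (trans h (sym (t≡ x))))

  _→ᴰ_ : {P : E → Set ℓ₂} {Q : E → Set ℓ₃} → Definable A κ P → Definable A κ Q →
         Definable A κ (λ x → P x → Q x)
  (φ , φ⇔) →ᴰ (ψ , ψ⇔) = φ ⇒ ψ , λ x →
    mk⇔ (λ h → to (ψ⇔ x) ∘ h ∘ from (φ⇔ x)) (λ h → from (ψ⇔ x) ∘ h ∘ to (φ⇔ x))

  ¬ᴰ_ : {P : E → Set ℓ₂} → Definable A κ P → Definable A κ (λ x → ¬ P x)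
  ¬ᴰ (φ , φ⇔) = ¬̇ φ , λ x →
    mk⇔ (λ h Px → Lift.lower (h (from (φ⇔ x) Px))) (λ h φx → lift (h (to (φ⇔ x) φx)))

  ∀ᴰ : {P : E → Carrier A → Set ℓ₂} →
       Definable A {E = Carrier A × E} (λ (y , x) → y ∷ κ x) (λ (y , x) → P x y) →
       Definable A κ (λ x → ∀ y → P x y)
  ∀ᴰ (φ , φ⇔) = ∀̇ φ , λ x → mk⇔ (λ h y → to (φ⇔ (y , x)) (h y)) (λ h y → from (φ⇔ (y , x)) (h y))

  imapᴰ : {P : E → Set ℓ₂} {Q : E → Set ℓ₃} → (∀ x → P x ⇔ Q x) → Definable A κ P → Definable A κ Q
  imapᴰ P⇔Q (φ , φ⇔) = φ , λ x → ⇔.trans (φ⇔ x) (P⇔Q x)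

  module _ (em : Classical) where

    ¬¬-elim : {P : Set ℓ₂} → ¬ ¬ P → P
    ¬¬-elim {P = P} ¬¬p with em {P = P}
    ... | yes p = p
    ... | no ¬p = contradiction ¬p ¬¬p

    _×ᴰ_ : {P : E → Set ℓ₂} {Q : E → Set ℓ₃} → Definable A κ P → Definable A κ Q →
           Definable A κ (λ x → P x × Q x)
    P ×ᴰ Q = imapᴰ (λ x → mk⇔ (λ h → ¬¬-elim (λ ¬h → h λ Px Qx → ¬h (Px , Qx)))
                              (λ (Px , Qx) h → h Px Qx)) (¬ᴰ (P →ᴰ (¬ᴰ Q)))

    _⊎ᴰ_ : {P : E → Set ℓ₂} {Q : E → Set ℓ₃} → Definable A κ P → Definable A κ Q →
           Definable A κ (λ x → P x ⊎ Q x)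
    P ⊎ᴰ Q = imapᴰ (λ x → mk⇔ (λ h → ¬¬-elim (λ ¬h → ¬h (inj₂ (h (¬h ∘ inj₁)))))
                              (λ { (inj₁ Px) ¬Px → contradiction Px ¬Px ; (inj₂ Qx) _ → Qx })) ((¬ᴰ P) →ᴰ Q)

    ∃ᴰ : {P : E → Carrier A → Set ℓ₂} →
         Definable A {E = Carrier A × E} (λ (y , x) → y ∷ κ x) (λ (y , x) → P x y) →
         Definable A κ (λ x → ∃ (P x))
    ∃ᴰ P = imapᴰ (λ x → mk⇔ (λ h → ¬¬-elim (λ ¬h → h λ y Py → ¬h (y , Py)))
                             (λ (y , Py) h → h y Py)) (¬ᴰ (∀ᴰ (¬ᴰ P)))

-- Definable subsets of an o-minimal line.

module OMinimal (em : Classical) {L : Language ℓ} (S : HasOrderedGroupSymbols L) (A : Structure L)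
  (isSTO : IsStrictTotalOrder _≡_ (less S A)) (omin : IsOMinimal S A) where

  open HasOrderedGroupSymbols S using (<ˢ)

  private
    C = Carrier A
    _<_ = less S A
    module STO = IsStrictTotalOrder isSTO

    variable
      E : Set ℓ₁
      κ : E → Vec C n

  open NonStrict _≡_ _<_ public using (_≤_; <⇒≤)
  open IsTotalOrder (NonStrict.isTotalOrder _≡_ _<_ isSTO) public
    using (antisym) renaming (refl to ≤-refl; trans to ≤-trans)

  infix 4 _≤ᵇ_

  <-≤-trans : ∀ {x y z} → x < y → y ≤ z → x < z
  <-≤-trans x<y (inj₁ y<z)  = STO.trans x<y y<z
  <-≤-trans x<y (inj₂ refl) = x<y

  ≤-<-trans : ∀ {x y z} → x ≤ y → y < z → x < z
  ≤-<-trans (inj₁ x<y)  y<z = STO.trans x<y y<z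
  ≤-<-trans (inj₂ refl) y<z = y<z

  <⇒≱ : ∀ {x y} → x < y → ¬ y ≤ x
  <⇒≱ x<y y≤x = STO.irrefl refl (<-≤-trans x<y y≤x)

  _≤ᵇ_ : ∀ x y → x ≤ y ⊎ y < x
  x ≤ᵇ y with STO.compare x y
  ... | tri< x<y _ _ = inj₁ (inj₁ x<y)
  ... | tri≈ _ x≡y _ = inj₁ (inj₂ x≡y)
  ... | tri> _ _ y<x = inj₂ y<x

  _<ᴰ_ : {f g : E → C} → TermFun A κ f → TermFun A κ g → Definable A κ (λ x → f x < g x)
  f <ᴰ g = relᴰ <ˢ (f ∷ᵀ g ∷ᵀ []ᵀ)

  _≤ᴰ_ : {f g : E → C} → TermFun A κ f → TermFun A κ g → Definable A κ (λ x → f x ≤ g x)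
  f ≤ᴰ g = _⊎ᴰ_ em (f <ᴰ g) (f ≡ᴰ g)

  -- Below y there is an alternating chain of points in X and outside X that
  -- leaves X for the k-th time, respectively is in X after leaving it k times.
  Leaves Enters : Pred C ℓ₂ → ℕ → Pred C (ℓ ⊔ ℓ₂)
  Leaves X zero    y = ⊤
  Leaves X (suc k) y = ∃[ z ] z ≤ y × Enters X k z × ¬ X z
  Enters X k       y = ∃[ z ] z ≤ y × Leaves X k z × X z

  -- If `X` has finitely many convex components, this is number k among them, counted from below
  -- starting at 0.
  Run : Pred C ℓ₂ → ℕ → Pred C (ℓ ⊔ ℓ₂)
  Run X k y = Enters X k y × ¬ Leaves X (suc k) y

  module _ {X : Pred C ℓ₂} where

    leaves-up : ∀ k {y z} → y ≤ z → Leaves X k y → Leaves X k z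
    leaves-up zero    _   _             = tt
    leaves-up (suc k) y≤z (u , u≤y , h) = u , ≤-trans u≤y y≤z , h

    enters-up : ∀ k {y z} → y ≤ z → Enters X k y → Enters X k z
    enters-up k y≤z (u , u≤y , h) = u , ≤-trans u≤y y≤z , h

    run-⊆ : ∀ k {y} → Run X k y → X y
    run-⊆ k {y} (enters , stays) =
      ¬¬-elim {A = A} em λ ¬Xy → stays (y , ≤-refl , enters , ¬Xy)

    run-convex : ∀ k {y u z} → Run X k y → Run X k z → y ≤ u → u ≤ z → Run X k u
    run-convex k (enters , _) (_ , stays) y≤u u≤z =
      enters-up k y≤u enters , λ leaves → stays (leaves-up (suc k) u≤z leaves)

    -- Descending from `K`, the first index at which `Leaves` holds is that of the run, with `y`
    -- itself as witness for `Enters`. The descent stops because `Leaves X 0` always holds.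
    run-∃ : ∀ K {y} → ¬ Leaves X K y → X y → ∃[ k ] Run X k y
    run-∃ zero    ¬leaves Xy = contradiction tt ¬leaves
    run-∃ (suc K) {y} ¬leaves Xy with em {P = Leaves X K y}
    ... | yes leaves = K , (y , ≤-refl , leaves , Xy) , ¬leaves
    ... | no ¬leaves′ = run-∃ K ¬leaves′ Xy

  module _ {X : E → Pred C ℓ₂} (Xᴰ : Definable A (λ ((y , x) : C × E) → y ∷ κ x) (λ (y , x) → X x y)) where

    leavesᴰ : ∀ k → Definable A (λ ((y , x) : C × E) → y ∷ κ x) (λ (y , x) → Leaves (X x) k y)
    entersᴰ : ∀ k → Definable A (λ ((y , x) : C × E) → y ∷ κ x) (λ (y , x) → Enters (X x) k y)
    leavesᴰ zero    = ⊥̇ ⇒ ⊥̇ , λ _ → mk⇔ (λ _ → tt) (λ _ → id)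
    leavesᴰ (suc k) = ∃ᴰ em (_×ᴰ_ em (headᵀ idᵀ ≤ᴰ headᵀ (tailᵀ idᵀ))
      (_∘ᴰ_ {g = λ (z , y , x) → z , x} (_×ᴰ_ em (entersᴰ k) (¬ᴰ Xᴰ)) (headᵀ idᵀ ∷ᵀ tailᵀ (tailᵀ idᵀ))))
    entersᴰ k = ∃ᴰ em (_×ᴰ_ em (headᵀ idᵀ ≤ᴰ headᵀ (tailᵀ idᵀ))
      (_∘ᴰ_ {g = λ (z , y , x) → z , x} (_×ᴰ_ em (leavesᴰ k) Xᴰ) (headᵀ idᵀ ∷ᵀ tailᵀ (tailᵀ idᵀ))))

    runᴰ : ∀ k → Definable A (λ ((y , x) : C × E) → y ∷ κ x) (λ (y , x) → Run (X x) k y)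
    runᴰ k = _×ᴰ_ em (entersᴰ k) (¬ᴰ leavesᴰ (suc k))

  open ExtremaStrict _<_ using (_<±_; ⊥±<[_]; [_]; [_]<⊤±)

  _∈ᵖ_ : C → Piece S A → Set ℓ
  _∈ᵖ_ = _∈ₚ_ S {A}

  <±-upʳ : ∀ {l x y} → l <± [ x ] → x ≤ y → l <± [ y ]
  <±-upʳ {⊥±}    _       _   = ⊥±<[ _ ]
  <±-upʳ {[ l ]} [ l<x ] x≤y = [ <-≤-trans l<x x≤y ]

  <±-downˡ : ∀ {u x y} → [ y ] <± u → x ≤ y → [ x ] <± u
  <±-downˡ {⊤±}    _       _   = [ _ ]<⊤±
  <±-downˡ {[ u ]} [ y<u ] x≤y = [ ≤-<-trans x≤y y<u ]

  piece-convex : ∀ P {x y z} → x ∈ᵖ P → z ∈ᵖ P → x ≤ y → y ≤ z → y ∈ᵖ P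
  piece-convex (point a) refl refl x≤y y≤z = antisym y≤z x≤y
  piece-convex (interval l u) (l<x , _) (_ , z<u) x≤y y≤z = <±-upʳ l<x x≤y , <±-downˡ z<u y≤z

  private
    indicator : {P : Set ℓ₂} → Dec P → ℕ
    indicator (yes _) = 1
    indicator (no _)  = 0

    Meets : C → Piece S A → Set ℓ
    Meets y P = ∃[ x ] x ≤ y × x ∈ᵖ P

    -- A counter for alternations: it grows at every return to the set, yet never exceeds the number
    -- of pieces.
    meeting : List (Piece S A) → C → ℕ
    meeting []       y = 0
    meeting (P ∷ Ps) y = indicator (em {P = Meets y P}) + meeting Ps y

    indicator-mono : {P : Set ℓ₂} {Q : Set ℓ₃} → (P → Q) → (P? : Dec P) (Q? : Dec Q) → indicator P? ℕ.≤ indicator Q?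
    indicator-mono f (yes p) (yes _) = ℕ.≤-refl
    indicator-mono f (yes p) (no ¬q) = contradiction (f p) ¬q
    indicator-mono f (no _)  _       = ℕ.z≤n

    indicator-strict : {P : Set ℓ₂} {Q : Set ℓ₃} → ¬ P → Q → (P? : Dec P) (Q? : Dec Q) → indicator P? ℕ.< indicator Q?
    indicator-strict ¬p q (yes p) _       = contradiction p ¬p
    indicator-strict ¬p q (no _)  (yes _) = ℕ.≤-refl
    indicator-strict ¬p q (no _)  (no ¬q) = contradiction q ¬q

    meets-up : ∀ {P y z} → y ≤ z → Meets y P → Meets z P
    meets-up y≤z (x , x≤y , x∈P) = x , ≤-trans x≤y y≤z , x∈P

    meeting-mono : ∀ Ps {y z} → y ≤ z → meeting Ps y ℕ.≤ meeting Ps z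
    meeting-mono []       y≤z = ℕ.z≤n
    meeting-mono (P ∷ Ps) y≤z = ℕ.+-mono-≤ (indicator-mono (meets-up {P} y≤z) em em) (meeting-mono Ps y≤z)

    -- The piece containing z has not been met at or below y, since by convexity it would then
    -- contain y.
    meeting-strict : ∀ Ps {y z} → y ≤ z → ¬ Anyᴸ (y ∈ᵖ_) Ps → Anyᴸ (z ∈ᵖ_) Ps → meeting Ps y ℕ.< meeting Ps z
    meeting-strict (P ∷ Ps) {y} {z} y≤z y∉ (here z∈P) = ℕ.+-mono-<-≤
      (indicator-strict (λ (x , x≤y , x∈P) → y∉ (here (piece-convex P x∈P z∈P x≤y y≤z))) (z , ≤-refl , z∈P) em em)
      (meeting-mono Ps y≤z)
    meeting-strict (P ∷ Ps) y≤z y∉ (there z∈Ps) = ℕ.+-mono-≤-<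
      (indicator-mono (meets-up {P} y≤z) em em) (meeting-strict Ps y≤z (y∉ ∘ there) z∈Ps)

    meeting-positive : ∀ Ps {z} → Anyᴸ (z ∈ᵖ_) Ps → 0 ℕ.< meeting Ps z
    meeting-positive (P ∷ Ps) {z} (here z∈P) with em {P = Meets z P}
    ... | yes _ = ℕ.s≤s ℕ.z≤n
    ... | no ¬m = contradiction (z , ≤-refl , z∈P) ¬m
    meeting-positive (P ∷ Ps) (there z∈Ps) = ℕ.≤-trans (meeting-positive Ps z∈Ps) (ℕ.m≤n+m _ _)

    meeting≤length : ∀ Ps y → meeting Ps y ℕ.≤ List.length Ps
    meeting≤length []       y = ℕ.z≤n
    meeting≤length (P ∷ Ps) y with em {P = Meets y P}
    ... | yes _ = ℕ.s≤s (meeting≤length Ps y)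
    ... | no _  = ℕ.m≤n⇒m≤1+n (meeting≤length Ps y)

    module _ {X : Pred C ℓ₂} {Ps} (X⇔ : ∀ x → X x ⇔ Anyᴸ (x ∈ᵖ_) Ps) where

      leaves⇒≤ : ∀ k {y} → Leaves X k y → k ℕ.≤ meeting Ps y
      enters⇒< : ∀ k {y} → Enters X k y → k ℕ.< meeting Ps y
      leaves⇒≤ zero    _ = ℕ.z≤n
      leaves⇒≤ (suc k) (z , z≤y , enters , _) = ℕ.≤-trans (enters⇒< k enters) (meeting-mono Ps z≤y)
      enters⇒< zero (z , z≤y , _ , Xz) =
        ℕ.≤-trans (meeting-positive Ps (to (X⇔ z) Xz)) (meeting-mono Ps z≤y)
      enters⇒< (suc k) (z , z≤y , (u , u≤z , enters , ¬Xu) , Xz) = ℕ.≤-trans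
        (ℕ.≤-<-trans (enters⇒< k enters) (meeting-strict Ps u≤z (¬Xu ∘ from (X⇔ u)) (to (X⇔ z) Xz)))
        (meeting-mono Ps z≤y)

  IsLub : Pred C ℓ₂ → Pred C (ℓ ⊔ ℓ₂)
  IsLub X s = (∀ x → X x → x ≤ s) × (∀ w → (∀ x → X x → x ≤ w) → s ≤ w)

  private
    Bounded : Pred C ℓ₂ → Set (ℓ ⊔ ℓ₂)
    Bounded X = ∃[ w ] ∀ x → X x → x ≤ w

    max-lub : {X : Pred C ℓ₂} → ∃[ s ] X s × (∀ x → X x → x ≤ s) → ∃ (IsLub X)
    max-lub (s , Xs , s-max) = s , s-max , λ w w-bound → w-bound s Xs

    -- For an interval without maximum the right endpoint is the supremum: a smaller upper bound
    -- would lie in the interval and be its maximum.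
    piece-lub : ∀ P {x} → x ∈ᵖ P → Bounded (_∈ᵖ P) → ∃ (IsLub (_∈ᵖ P))
    piece-lub (point a) _ _ = max-lub (a , refl , λ _ → inj₂)
    piece-lub (interval l ⊤±) {x} (l<x , _) (w , w-bound) =
      max-lub (w , (<±-upʳ l<x (w-bound x (l<x , [ _ ]<⊤±)) , [ _ ]<⊤±) , w-bound)
    piece-lub (interval l ⊥±) (_ , Supremum.[ () ])
    piece-lub (interval l [ u ]) {x} (l<x , [ x<u ])
      with em {P = ∃[ s ] s ∈ᵖ interval l [ u ] × (∀ x → x ∈ᵖ interval l [ u ] → x ≤ s)}
    ... | yes max = λ _ → max-lub max
    ... | no ¬max = λ _ → u , (λ { _ (_ , [ y<u ]) → <⇒≤ y<u }) , least
      where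
      least : ∀ w → (∀ x → x ∈ᵖ interval l [ u ] → x ≤ w) → u ≤ w
      least w w-bound with u ≤ᵇ w
      ... | inj₁ u≤w = u≤w
      ... | inj₂ w<u = contradiction
        (w , (<±-upʳ l<x (w-bound x (l<x , [ x<u ])) , [ w<u ]) , w-bound) ¬max

    pieces-lub : ∀ Ps {x} → Anyᴸ (x ∈ᵖ_) Ps → Bounded (λ x → Anyᴸ (x ∈ᵖ_) Ps) → ∃ (IsLub (λ x → Anyᴸ (x ∈ᵖ_) Ps))
    pieces-lub (P ∷ Ps) x∈ (w , w-bound)
      with em {P = ∃[ x ] x ∈ᵖ P} | em {P = ∃[ x ] Anyᴸ (x ∈ᵖ_) Ps}
    pieces-lub (P ∷ Ps) (here x∈P) _ | no ∄ | _ = contradiction (_ , x∈P) ∄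
    pieces-lub (P ∷ Ps) (there x∈Ps) _ | _ | no ∄ = contradiction (_ , x∈Ps) ∄
    pieces-lub (P ∷ Ps) (here x∈P) (w , w-bound) | yes _ | no ∄
      with s , s-bound , s-least ← piece-lub P x∈P (w , λ x x∈P → w-bound x (here x∈P)) =
      s , (λ { x (here x∈P) → s-bound x x∈P ; x (there x∈Ps) → contradiction (x , x∈Ps) ∄ })
        , λ v v-bound → s-least v λ x x∈P → v-bound x (here x∈P)
    pieces-lub (P ∷ Ps) (there x∈Ps) (w , w-bound) | no ∄ | yes _
      with s , s-bound , s-least ← pieces-lub Ps x∈Ps (w , λ x x∈Ps → w-bound x (there x∈Ps)) =
      s , (λ { x (there x∈Ps) → s-bound x x∈Ps ; x (here x∈P) → contradiction (x , x∈P) ∄ })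
        , λ v v-bound → s-least v λ x x∈P → v-bound x (there x∈P)
    pieces-lub (P ∷ Ps) _ (w , w-bound) | yes (_ , x∈P) | yes (_ , x∈Ps)
      with piece-lub P x∈P (w , λ x x∈P → w-bound x (here x∈P))
         | pieces-lub Ps x∈Ps (w , λ x x∈Ps → w-bound x (there x∈Ps))
    ... | s , s-bound , s-least | t , t-bound , t-least with s ≤ᵇ t
    ...   | inj₁ s≤t = t
      , (λ { x (here x∈P) → ≤-trans (s-bound x x∈P) s≤t ; x (there x∈Ps) → t-bound x x∈Ps })
      , λ v v-bound → t-least v λ x x∈Ps → v-bound x (there x∈Ps)
    ...   | inj₂ t<s = s
      , (λ { x (here x∈P) → s-bound x x∈P ; x (there x∈Ps) → ≤-trans (t-bound x x∈Ps) (<⇒≤ t<s) })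
      , λ v v-bound → s-least v λ x x∈P → v-bound x (here x∈P)

  module _ {X : E → Pred C ℓ₂} (Xᴰ : Definable A (λ ((y , x) : C × E) → y ∷ κ x) (λ (y , x) → X x y)) (x : E) where

    private
      Ps = proj₁ (omin (formula Xᴰ) (κ x))
      X⇔ : ∀ y → X x y ⇔ Anyᴸ (y ∈ᵖ_) Ps
      X⇔ y = mk⇔ (to Ps⇔ ∘ from (⊨-formula Xᴰ (y , x))) (to (⊨-formula Xᴰ (y , x)) ∘ from Ps⇔)
        where Ps⇔ = proj₂ (omin (formula Xᴰ) (κ x)) y

    leaves-bounded : ∃[ K ] ∀ y → ¬ Leaves (X x) K y
    leaves-bounded = suc (List.length Ps) , λ y leaves →
      ℕ.<⇒≱ (leaves⇒≤ X⇔ _ leaves) (meeting≤length Ps y)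

    definable-lub : ∀ {y} → X x y → Bounded (X x) → ∃ (IsLub (X x))
    definable-lub Xy (w , w-bound)
      with s , s-bound , s-least ← pieces-lub Ps (to (X⇔ _) Xy) (w , λ z z∈ → w-bound z (from (X⇔ z) z∈)) =
      s , (λ z Xz → s-bound z (to (X⇔ z) Xz))
        , λ v v-bound → s-least v λ z z∈ → v-bound z (from (X⇔ z) z∈)

-- Generated substructures and definable closure.

module _ {L : Language ℓ} {A : Structure L} where

  private
    C = Carrier A
    variable
      X Y : Pred C ℓ

  ⟨⟩-bind  : X ⊆ ⟨ A ⟩ Y → ⟨ A ⟩ X ⊆ ⟨ A ⟩ Y
  ⟨⟩-bind* : X ⊆ ⟨ A ⟩ Y → {v : Vec C n} → All (⟨ A ⟩ X) v → All (⟨ A ⟩ Y) v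
  ⟨⟩-bind X⊆ (gen Xx)   = X⊆ Xx
  ⟨⟩-bind X⊆ (app F xs) = app F (⟨⟩-bind* X⊆ xs)
  ⟨⟩-bind* X⊆ []       = []
  ⟨⟩-bind* X⊆ (x ∷ xs) = ⟨⟩-bind X⊆ x ∷ ⟨⟩-bind* X⊆ xs

  ⟨⟩-mono : X ⊆ Y → ⟨ A ⟩ X ⊆ ⟨ A ⟩ Y
  ⟨⟩-mono X⊆Y = ⟨⟩-bind (gen ∘ X⊆Y)

  eval-closed  : {B : Pred C ℓ} → IsClosed A B → {v : Vec C n} → All B v → (t : Term L n) → B (eval A v t)
  evals-closed : {B : Pred C ℓ} → IsClosed A B → {v : Vec C n} → All B v → (ts : Vec (Term L n) k) → All B (evals A v ts)
  eval-closed cl Bv (var i)    = All.lookup⁺ Bv i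
  eval-closed cl Bv (app F ts) = cl F (evals-closed cl Bv ts)
  evals-closed cl Bv []       = []
  evals-closed cl Bv (t ∷ ts) = eval-closed cl Bv t ∷ evals-closed cl Bv ts

  ∈-eval : (v : Vec C n) {x : C} → x ∈ᵛ v → Σ[ t ∈ Term L n ] eval A v t ≡ x
  ∈-eval (_ ∷ v) (here refl) = var zero , refl
  ∈-eval (y ∷ v) (there x∈) with ∈-eval v x∈
  ... | t , t≡ with shift ← _∘ᵀ_ {A = A} {κ = id} {κ′ = id} {g = tail} {f = λ v → eval A v t} (t , λ _ → refl) (tailᵀ idᵀ) =
    term shift , trans (eval-term shift (y ∷ v)) t≡

  -- The elements of `X` that occur are collected afresh for each subterm, while the tuple `d` is
  -- shared by all of them.
  span-term  : (d : Vec C m) {x : C} → ⟨ A ⟩ (X ∪ (_∈ᵛ d)) x →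
    Σ[ n ∈ ℕ ] Σ[ w ∈ Vec C n ] All X w × Σ[ t ∈ Term L (n + m) ] eval A (w ++ d) t ≡ x
  span-terms : (d : Vec C m) {xs : Vec C k} → All (⟨ A ⟩ (X ∪ (_∈ᵛ d))) xs →
    Σ[ n ∈ ℕ ] Σ[ w ∈ Vec C n ] All X w × Σ[ ts ∈ Vec (Term L (n + m)) k ] evals A (w ++ d) ts ≡ xs
  span-term d (gen (inj₁ Xx)) = 1 , _ ∷ [] , Xx ∷ [] , var zero , refl
  span-term d (gen (inj₂ x∈d)) = 0 , [] , [] , ∈-eval d x∈d
  span-term d (app F xs) with n , w , Xw , ts , ts≡ ← span-terms d xs =
    n , w , Xw , app F ts , cong (fun A F) ts≡
  span-terms d [] = 0 , [] , [] , [] , refl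
  span-terms {m = m} d (x ∷ xs) with n₁ , w₁ , Xw₁ , t , t≡ ← span-term d x
                     | n₂ , w₂ , Xw₂ , ts , ts≡ ← span-terms d xs =
    n₁ + n₂ , w₁ ++ w₂ , All.++⁺ Xw₁ Xw₂ , terms both ,
    trans (evals-terms both (w₁ , w₂ , d)) (cong₂ _∷_ t≡ ts≡)
    where
    E = Vec C n₁ × Vec C n₂ × Vec C m
    κ : E → Vec C ((n₁ + n₂) + m)
    κ (w₁ , w₂ , d) = (w₁ ++ w₂) ++ d
    w₁w₂ : TermFuns A κ (λ (w₁ , w₂ , d) → w₁ ++ w₂)
    w₁w₂ = ++⁻ˡ (n₁ + n₂) idᵀ
    dᵀ : TermFuns A κ (λ (w₁ , w₂ , d) → d)
    dᵀ = ++⁻ʳ (n₁ + n₂) {f = λ (w₁ , w₂ , d) → w₁ ++ w₂} idᵀ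
    both : TermFuns A κ (λ (w₁ , w₂ , d) → eval A (w₁ ++ d) t ∷ evals A (w₂ ++ d) ts)
    both = evalᵀ t (++⁻ˡ n₁ w₁w₂ ++ᵀ dᵀ) ∷ᵀ evalsᵀ ts (++⁻ʳ n₁ {f = λ (w₁ , w₂ , d) → w₁} w₁w₂ ++ᵀ dᵀ)

  ∈-terms : (v : Vec C m) {xs : Vec C k} → All (⟨ A ⟩ (_∈ᵛ v)) xs →
            Σ[ ts ∈ Vec (Term L m) k ] evals A v ts ≡ xs
  ∈-term  : (v : Vec C m) {x : C} → ⟨ A ⟩ (_∈ᵛ v) x → Σ[ t ∈ Term L m ] eval A v t ≡ x
  ∈-term v (gen x∈v) = ∈-eval v x∈v
  ∈-term v (app F xs) with ts , ts≡ ← ∈-terms v xs = app F ts , cong (fun A F) ts≡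
  ∈-terms v [] = [] , refl
  ∈-terms v (x ∷ xs) with t , t≡ ← ∈-term v x | ts , ts≡ ← ∈-terms v xs = t ∷ ts , cong₂ _∷_ t≡ ts≡

  module _ {B : Pred C ℓ} (cl : IsClosed A B) where

    private
      𝔹 = substructure A B cl

      value-injective : {x y : Carrier 𝔹} → value x ≡ value y → x ≡ y
      value-injective {_ , _} {_ , _} refl = refl

    value-eval  : (v : Vec (Carrier 𝔹) n) (t : Term L n) → value (eval 𝔹 v t) ≡ eval A (map value v) t
    value-evals : (v : Vec (Carrier 𝔹) n) (ts : Vec (Term L n) k) → map value (evals 𝔹 v ts) ≡ evals A (map value v) ts
    value-eval v (var i)    = sym (lookup-map i value v)
    value-eval v (app F ts) = cong (fun A F) (value-evals v ts)
    value-evals v []       = refl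
    value-evals v (t ∷ ts) = cong₂ _∷_ (value-eval v t) (value-evals v ts)

    quantifierFree-absolute : {φ : Formula L n} → QuantifierFree φ → ∀ v →
                              𝔹 ⊨ φ [ v ] ⇔ A ⊨ φ [ map value v ]
    quantifierFree-absolute (s ≐ t) v = mk⇔
      (λ eq → trans (sym (value-eval v s)) (trans (cong value eq) (value-eval v t)))
      (λ eq → value-injective (trans (value-eval v s) (trans eq (sym (value-eval v t)))))
    quantifierFree-absolute (rel R ts) v rewrite value-evals v ts = ⇔.refl
    quantifierFree-absolute ⊥̇ v = ⇔.refl
    quantifierFree-absolute (φ ⇒ ψ) v =
      mk⇔ (λ h → to ψ⇔ ∘ h ∘ from φ⇔) (λ h → from ψ⇔ ∘ h ∘ to φ⇔)
      where
      φ⇔ = quantifierFree-absolute φ v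
      ψ⇔ = quantifierFree-absolute ψ v

    universal-down : {φ : Formula L n} → Universal φ → ∀ v → A ⊨ φ [ map value v ] → 𝔹 ⊨ φ [ v ]
    universal-down (qf φ) v h = from (quantifierFree-absolute φ v) h
    universal-down (∀̇ φ)  v h x = universal-down φ (x ∷ v) (h (value x))

    -- Universal axioms pass down to closed subsets, so the substructure is again a model of `T`.
    -- Quantifier elimination in both models then reduces elementarity to quantifier-free formulas,
    -- which are absolute.
    closed-elementary : (T : Theory L) → HasQE T → HasUniversalAxiomatization T → A isModelOf T →
                        IsElementarySubstructure A B
    closed-elementary T qe (U , U-universal , T⇔U) A⊨T = record
      { closed     = cl
      ; elementary = λ φ v → let ψ , ψ-qf , φ⇔ψ = qe φ in
          ⇔.trans (φ⇔ψ 𝔹 𝔹⊨T v) (⇔.trans (quantifierFree-absolute ψ-qf v) (⇔.sym (φ⇔ψ A A⊨T (map value v))))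
      }
      where
      𝔹⊨T : 𝔹 isModelOf T
      𝔹⊨T = from (T⇔U 𝔹) λ σ Uσ → universal-down (U-universal σ Uσ) [] (to (T⇔U A) A⊨T σ Uσ)

  module _ (em : Classical) where

    -- If a were outside `B`, its uniqueness would leave no solution of `P` in `B`; elementarity
    -- carries this negative statement to `A`, where a refutes it.
    elementary-dcl : {B : Pred C ℓ} → IsElementarySubstructure A B →
      {P : C × Vec C k → Set ℓ₂} → Definable A (λ (y , w) → y ∷ w) P →
      {a : C} {w : Vec C k} → All B w → P (a , w) → (∀ y → P (y , w) → y ≡ a) → B a
    elementary-dcl {B = B} B≼A {P} Pᴰ {a} Bw Pa unique = ¬¬-elim {A = A} em λ ¬Ba →
      let
        𝔹⊨∀¬ : 𝔹 ⊨ ∀̇ ¬̇ formula Pᴰ [ refined Bw ]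
        -- Membership in the substructure is irrelevant, so it is available only for deriving a
        -- contradiction.
        𝔹⊨∀¬ = λ { x@(y , Irrelevant.[ By ]) φx → contradiction-irr By λ By → ¬Ba (subst B
          (unique y (to (⊨-formula Pᴰ (y , _)) (subst (λ w → A ⊨ formula Pᴰ [ y ∷ w ]) (value-refined Bw)
            (to (elementary (formula Pᴰ) (x ∷ refined Bw)) φx)))) By) }
        A⊨∀¬ = subst (λ w → A ⊨ ∀̇ ¬̇ formula Pᴰ [ w ]) (value-refined Bw)
          (to (elementary (∀̇ ¬̇ formula Pᴰ) (refined Bw)) 𝔹⊨∀¬)
      in Lift.lower (A⊨∀¬ a (from (⊨-formula Pᴰ (a , _)) Pa))
      where
      open IsElementarySubstructure B≼A
      𝔹 = substructure A B closed
      refined : {w : Vec C n} → All B w → Vec (Carrier 𝔹) n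
      refined []        = []
      refined (Bx ∷ Bw) = (_ , Irrelevant.[ Bx ]) ∷ refined Bw
      value-refined : {w : Vec C n} (Bw : All B w) → map value (refined Bw) ≡ w
      value-refined []        = refl
      value-refined (Bx ∷ Bw) = cong (_ ∷_) (value-refined Bw)

-- The exchange property and Steinitz's lemma.

module Exchange (em : Classical) {L : Language ℓ} (S : HasOrderedGroupSymbols L) (A : Structure L)
  (isSTO : IsStrictTotalOrder _≡_ (less S A)) (omin : IsOMinimal S A)
  (generated-elementary : ∀ X → IsElementarySubstructure A (⟨ A ⟩ X)) where

  open OMinimal em S A isSTO omin

  private
    C = Carrier A
    _<_ = less S A
    variable
      X Y : Pred C ℓ

  Constant : (C → C) → C → C → Set ℓ
  Constant F y z = ∀ u → y ≤ u → u ≤ z → F u ≡ F y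

  -- Local constancy of `F` at y, with points required on both sides.
  Inner : (C → C) → C → Set ℓ
  Inner F y = (∃[ z ] y < z × Constant F y z) × (∃[ z ] z < y × Constant F z y)

  module _ {E : Set ℓ₁} {κ : E → Vec C n} {F : E → C → C}
    (Fᵀ : TermFun A (λ ((y , x) : C × E) → y ∷ κ x) (λ (y , x) → F x y)) where

    constantᴰ : Definable A (λ ((y , z , x) : C × C × E) → y ∷ z ∷ κ x) (λ (y , z , x) → Constant (F x) y z)
    constantᴰ = ∀ᴰ ((headᵀ (tailᵀ idᵀ) ≤ᴰ headᵀ idᵀ) →ᴰ ((headᵀ idᵀ ≤ᴰ headᵀ (tailᵀ (tailᵀ idᵀ))) →ᴰ
      ( _∘ᵀ_ {g = λ (u , y , z , x) → u , x} Fᵀ (headᵀ idᵀ ∷ᵀ tailᵀ (tailᵀ (tailᵀ idᵀ)))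
      ≡ᴰ _∘ᵀ_ {g = λ (u , y , z , x) → y , x} Fᵀ (tailᵀ (headᵀ idᵀ ∷ᵀ headᵀ (tailᵀ idᵀ) ∷ᵀ tailᵀ (tailᵀ (tailᵀ idᵀ)))))))

    innerᴰ : Definable A (λ ((y , x) : C × E) → y ∷ κ x) (λ (y , x) → Inner (F x) y)
    innerᴰ = _×ᴰ_ em
      (∃ᴰ em (_×ᴰ_ em (headᵀ (tailᵀ idᵀ) <ᴰ headᵀ idᵀ)
        (_∘ᴰ_ {g = λ (z , y , x) → y , z , x} constantᴰ (headᵀ (tailᵀ idᵀ) ∷ᵀ headᵀ idᵀ ∷ᵀ tailᵀ (tailᵀ idᵀ)))))
      (∃ᴰ em (_×ᴰ_ em (headᵀ idᵀ <ᴰ headᵀ (tailᵀ idᵀ)) constantᴰ))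

    -- Definable connectedness. Let s be the supremum of those u in [y, z] for which `F` is constant
    -- on [y, u]. Local constancy on the left of s makes `F` constant up to s; on the right it
    -- either goes beyond the supremum, which is absurd, or already reaches z.
    run-constant : ∀ k x {y z} → Run (Inner (F x)) k y → Run (Inner (F x)) k z → y ≤ z → F x z ≡ F x y
    run-constant k x {y} {z} run-y run-z y≤z with definable-lub Iᴰ (z , y , x)
      (≤-refl , y≤z , λ u y≤u u≤y → cong (F x) (antisym u≤y y≤u)) (z , λ u (_ , u≤z , _) → u≤z)
      where
      I : C × C × E → C → Set ℓ
      I (z , y , x) u = y ≤ u × u ≤ z × Constant (F x) y u
      Iᴰ : Definable A (λ ((u , z , y , x) : C × C × C × E) → u ∷ z ∷ y ∷ κ x) (λ (u , e) → I e u)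
      Iᴰ = _×ᴰ_ em (headᵀ (tailᵀ (tailᵀ idᵀ)) ≤ᴰ headᵀ idᵀ) (_×ᴰ_ em (headᵀ idᵀ ≤ᴰ headᵀ (tailᵀ idᵀ))
        (_∘ᴰ_ {g = λ (u , z , y , x) → y , u , x} constantᴰ
          (headᵀ (tailᵀ (tailᵀ idᵀ)) ∷ᵀ headᵀ idᵀ ∷ᵀ tailᵀ (tailᵀ (tailᵀ idᵀ)))))
    ... | s , s-bound , s-least
      with y≤s ← s-bound y (≤-refl , y≤z , λ u y≤u u≤y → cong (F x) (antisym u≤y y≤u))
         | s≤z ← s-least z (λ u (_ , u≤z , _) → u≤z)
      with (v , s<v , sv) , (w , w<s , ws) ← run-⊆ k (run-convex k run-y run-z y≤s s≤z)
      with em {P = Constant (F x) y s}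
    ... | yes ys = ys′ s≤z
      where
      ys′ : s ≤ z → F x z ≡ F x y
      ys′ (inj₂ refl) = ys z y≤s ≤-refl
      ys′ (inj₁ s<z) with v ≤ᵇ z
      ... | inj₁ v≤z = contradiction (s-bound v (≤-trans y≤s (<⇒≤ s<v) , v≤z , yv)) (<⇒≱ s<v)
        where
        yv : Constant (F x) y v
        yv u y≤u u≤v with u ≤ᵇ s
        ... | inj₁ u≤s = ys u y≤u u≤s
        ... | inj₂ s<u = trans (sv u (<⇒≤ s<u) u≤v) (ys s y≤s ≤-refl)
      ... | inj₂ z<v = trans (sv z s≤z (<⇒≤ z<v)) (ys s y≤s ≤-refl)
    ... | no ¬ys = contradiction ys ¬ys
      where
      -- Some u ∈ I with w < u ≤ s carries constancy over to s.
      ys : Constant (F x) y s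
      ys with em {P = ∃[ u ] (y ≤ u × u ≤ z × Constant (F x) y u) × w < u}
      ... | yes (u , u∈I@(y≤u , _ , yu) , w<u) = λ t y≤t t≤s → case t ≤ᵇ u of λ where
              (inj₁ t≤u) → yu t y≤t t≤u
              (inj₂ u<t) → trans (ws t (≤-trans (<⇒≤ w<u) (<⇒≤ u<t)) t≤s)
                (trans (sym (ws u (<⇒≤ w<u) (s-bound u u∈I))) (yu u y≤u ≤-refl))
      ... | no ∄ = contradiction (s-least w λ u u∈I → case u ≤ᵇ w of λ where
              (inj₁ u≤w) → u≤w
              (inj₂ w<u) → contradiction (u , u∈I , w<u) ∄) (<⇒≱ w<s)

  -- If b is interior to a fibre of F and to the run of such points around it,
  -- F is constant on that run, which is definable without b; otherwise b is an
  -- extremum of a run of the fibre over F b.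
  exchange : ∀ (t : Term L (suc k)) (w : Vec C k) b → let a = eval A (b ∷ w) t in
             ⟨ A ⟩ (_∈ᵛ w) a ⊎ ⟨ A ⟩ (_∈ᵛ (a ∷ w)) b
  exchange {k = k} t w b = by-cases (em {P = Inner (F w) b})
    where
    a = eval A (b ∷ w) t
    F : Vec C k → C → C
    F w y = eval A (y ∷ w) t

    Fᵀ : TermFun A (λ ((y , w) : C × Vec C k) → y ∷ w) (λ (y , w) → F w y)
    Fᵀ = evalᵀ t idᵀ

    all∈ : ∀ {n} (v : Vec C n) → All (⟨ A ⟩ (_∈ᵛ v)) v
    all∈ v = All.lookup⁻ λ i → gen (∈-lookup i v)

    Fibre : Vec C (suc k) → C → Set ℓ
    Fibre v y = F (tail v) y ≡ head v
    fibreᴰ : Definable A (λ (y , v) → y ∷ v) (λ (y , v) → Fibre v y)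
    fibreᴰ = _∘ᵀ_ {g = λ (y , v) → y , tail v} Fᵀ (headᵀ idᵀ ∷ᵀ tailᵀ (tailᵀ idᵀ)) ≡ᴰ headᵀ (tailᵀ idᵀ)

    by-cases : Dec (Inner (F w) b) → ⟨ A ⟩ (_∈ᵛ w) a ⊎ ⟨ A ⟩ (_∈ᵛ (a ∷ w)) b
    by-cases (yes inner)
      with j , run-b ← run-∃ _ (proj₂ (leaves-bounded (innerᴰ Fᵀ) w) b) inner =
      inj₁ (elementary-dcl em (generated-elementary _) Pᴰ (all∈ w) (b , run-b , refl) unique)
      where
      P : C × Vec C k → Set ℓ
      P (z , w) = ∃[ y ] Run (Inner (F w)) j y × F w y ≡ z
      Pᴰ : Definable A (λ (z , w) → z ∷ w) P
      Pᴰ = ∃ᴰ em (_×ᴰ_ em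
        (_∘ᴰ_ {g = λ (y , z , w) → y , w} (runᴰ (innerᴰ Fᵀ) j) (headᵀ idᵀ ∷ᵀ tailᵀ (tailᵀ idᵀ)))
        (_∘ᵀ_ {g = λ (y , z , w) → y , w} Fᵀ (headᵀ idᵀ ∷ᵀ tailᵀ (tailᵀ idᵀ)) ≡ᴰ headᵀ (tailᵀ idᵀ)))
      unique : ∀ z → P (z , w) → z ≡ a
      unique z (y , run-y , refl) with y ≤ᵇ b
      ... | inj₁ y≤b = sym (run-constant Fᵀ j w run-y run-b y≤b)
      ... | inj₂ b<y = run-constant Fᵀ j w run-b run-y (<⇒≤ b<y)
    by-cases (no ¬inner)
      with j , run-b ← run-∃ _ (proj₂ (leaves-bounded fibreᴰ (a ∷ w)) b) refl = inj₂ (by-cases′ j run-b)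
      where
      module _ (j : ℕ) (run-b : Run (Fibre (a ∷ w)) j b) where

        run⇒constant : ∀ {y z} → Run (Fibre (a ∷ w)) j y → Run (Fibre (a ∷ w)) j z → Constant (F w) y z
        run⇒constant run-y run-z u y≤u u≤z =
          trans (run-⊆ j (run-convex j run-y run-z y≤u u≤z)) (sym (run-⊆ j run-y))

        runs = _∘ᴰ_ {g = λ (z , y , v) → z , v} (runᴰ fibreᴰ j) (headᵀ idᵀ ∷ᵀ tailᵀ (tailᵀ idᵀ))

        P Q : C × Vec C (suc k) → Set ℓ
        P (y , v) = Run (Fibre v) j y × (∀ z → Run (Fibre v) j z → z ≤ y)
        Q (y , v) = Run (Fibre v) j y × (∀ z → Run (Fibre v) j z → y ≤ z)
        Pᴰ : Definable A (λ (y , v) → y ∷ v) P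
        Pᴰ = _×ᴰ_ em (runᴰ fibreᴰ j) (∀ᴰ (runs →ᴰ (headᵀ idᵀ ≤ᴰ headᵀ (tailᵀ idᵀ))))
        Qᴰ : Definable A (λ (y , v) → y ∷ v) Q
        Qᴰ = _×ᴰ_ em (runᴰ fibreᴰ j) (∀ᴰ (runs →ᴰ (headᵀ (tailᵀ idᵀ) ≤ᴰ headᵀ idᵀ)))

        by-cases′ : ⟨ A ⟩ (_∈ᵛ (a ∷ w)) b
        by-cases′ with em {P = ∃[ z ] b < z × Run (Fibre (a ∷ w)) j z} | em {P = ∃[ z ] z < b × Run (Fibre (a ∷ w)) j z}
        -- Points of the run on both sides of b would make `F` constant around b.
        ... | yes (z , b<z , run-z) | yes (z′ , z′<b , run-z′) = contradiction
          ((z , b<z , run⇒constant run-b run-z) , (z′ , z′<b , run⇒constant run-z′ run-b)) ¬inner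
        ... | no ∄ | _ = elementary-dcl em (generated-elementary _) Pᴰ (all∈ (a ∷ w)) (run-b , max)
          (λ y (run-y , y-max) → antisym (max y run-y) (y-max b run-b))
          where
          max : ∀ z → Run (Fibre (a ∷ w)) j z → z ≤ b
          max z run-z with z ≤ᵇ b
          ... | inj₁ z≤b = z≤b
          ... | inj₂ b<z = contradiction (z , b<z , run-z) ∄
        ... | yes _ | no ∄ = elementary-dcl em (generated-elementary _) Qᴰ (all∈ (a ∷ w)) (run-b , min)
          (λ y (run-y , y-min) → antisym (y-min b run-b) (min y run-y))
          where
          min : ∀ z → Run (Fibre (a ∷ w)) j z → b ≤ z
          min z run-z with b ≤ᵇ z
          ... | inj₁ b≤z = b≤z
          ... | inj₂ z<b = contradiction (z , z<b , run-z) ∄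

  ⟨⟩-exchange : ∀ {a b} → ⟨ A ⟩ (X ∪ (_≡ b)) a → ¬ ⟨ A ⟩ X a → ⟨ A ⟩ (X ∪ (_≡ a)) b
  ⟨⟩-exchange {X = X} {b = b} a∈ a∉
    with n , w , Xw , t , refl ← span-term (b ∷ []) (⟨⟩-mono {Y = X ∪ (_∈ᵛ (b ∷ []))}
      (λ { (inj₁ Xx) → inj₁ Xx ; (inj₂ x≡b) → inj₂ (here x≡b) }) a∈)
    with tᵇ ← evalᵀ {A = A} {κ = λ ((b , w) : C × Vec C n) → b ∷ w} t (tailᵀ idᵀ ++ᵀ headᵀ idᵀ ∷ᵀ []ᵀ)
    with t≡ ← eval-term tᵇ (b , w)
    with exchange (term tᵇ) w b
  ... | inj₁ a∈⟨w⟩ = contradiction (⟨⟩-mono (λ x∈ → All.lookup Xw x∈) (subst (⟨ A ⟩ _) t≡ a∈⟨w⟩)) a∉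
  ... | inj₂ b∈⟨aw⟩ = ⟨⟩-mono (λ { (here refl) → inj₂ t≡ ; (there x∈) → inj₁ (All.lookup Xw x∈) }) b∈⟨aw⟩

  -- Each entry is compared only with those after it: tuples grow at the front, so a prolongation
  -- adds a single condition.
  Independent : Pred C ℓ → Vec C n → Set ℓ
  Independent X []       = ⊤
  Independent X (x ∷ xs) = ¬ ⟨ A ⟩ (X ∪ (_∈ᵛ xs)) x × Independent X xs

  private
    -- The entry replaced by x is the first one for which the entries after it no longer generate x
    -- over `Y`; exchange recovers it from x and those later entries.
    drop-one : ∀ {Y x} (d : Vec C n) → ⟨ A ⟩ (Y ∪ (_∈ᵛ d)) x → ¬ ⟨ A ⟩ Y x →
      Σ[ m ∈ ℕ ] Σ[ d′ ∈ Vec C m ] suc m ≡ n × ⟨ A ⟩ (Y ∪ (_∈ᵛ d)) ⊆ ⟨ A ⟩ ((Y ∪ (_≡ x)) ∪ (_∈ᵛ d′))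
    drop-one [] x∈ x∉ = contradiction (⟨⟩-mono (λ { (inj₁ Yx) → Yx ; (inj₂ ()) }) x∈) x∉
    drop-one {Y = Y} {x} (u ∷ d) x∈ x∉ with em {P = ⟨ A ⟩ (Y ∪ (_∈ᵛ d)) x}
    ... | yes x∈d with m , d′ , refl , ⊆d′ ← drop-one d x∈d x∉ =
      suc m , u ∷ d′ , refl , ⟨⟩-bind λ where
        (inj₁ Yz) → gen (inj₁ (inj₁ Yz))
        (inj₂ (here z≡u)) → gen (inj₂ (here z≡u))
        (inj₂ (there z∈d)) → ⟨⟩-mono (λ { (inj₁ z) → inj₁ z ; (inj₂ z∈) → inj₂ (there z∈) }) (⊆d′ (gen (inj₂ z∈d)))
    ... | no x∉d = _ , d , refl , ⟨⟩-bind λ where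
        (inj₁ Yz) → gen (inj₁ (inj₁ Yz))
        (inj₂ (there z∈d)) → gen (inj₂ z∈d)
        (inj₂ (here refl)) → ⟨⟩-mono
          (λ { (inj₁ (inj₁ Yz)) → inj₁ (inj₁ Yz) ; (inj₁ (inj₂ z∈d)) → inj₂ z∈d ; (inj₂ z≡x) → inj₁ (inj₂ z≡x) })
          (⟨⟩-exchange (⟨⟩-mono (λ { (inj₁ Yz) → inj₁ (inj₁ Yz) ; (inj₂ (here z≡u)) → inj₂ z≡u
                                   ; (inj₂ (there z∈d)) → inj₁ (inj₂ z∈d) }) x∈) x∉d)

  -- The entries of c are exchanged in from the last one on, so that when x enters, the entries it
  -- is independent of already belong to the base.
  steinitz : ∀ (d : Vec C n) (c : Vec C m) → Independent X c → All (⟨ A ⟩ (X ∪ (_∈ᵛ d))) c →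
    Σ[ l ∈ ℕ ] Σ[ d′ ∈ Vec C l ] m + l ≡ n × ⟨ A ⟩ (X ∪ (_∈ᵛ d)) ⊆ ⟨ A ⟩ ((X ∪ (_∈ᵛ c)) ∪ (_∈ᵛ d′))
  steinitz d [] _ _ = _ , d , refl , ⟨⟩-mono λ { (inj₁ Xz) → inj₁ (inj₁ Xz) ; (inj₂ z∈d) → inj₂ z∈d }
  steinitz {X = X} d (x ∷ c) (x∉ , indep) (x∈ ∷ c∈)
    with l , d′ , refl , d⊆ ← steinitz d c indep c∈
    with l′ , d″ , refl , d′⊆ ← drop-one d′ (d⊆ x∈) x∉ =
    l′ , d″ , sym (ℕ.+-suc _ l′) , λ z∈ → ⟨⟩-mono (λ where
      (inj₁ (inj₁ (inj₁ Xz))) → inj₁ (inj₁ Xz)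
      (inj₁ (inj₁ (inj₂ z∈c))) → inj₁ (inj₂ (there z∈c))
      (inj₁ (inj₂ z≡x)) → inj₁ (inj₂ (here z≡x))
      (inj₂ z∈d″) → inj₂ z∈d″) (d′⊆ (d⊆ z∈))

  independent⇒≤ : ∀ (d : Vec C n) (c : Vec C m) → Independent X c → All (⟨ A ⟩ (X ∪ (_∈ᵛ d))) c → m ℕ.≤ n
  independent⇒≤ d c indep c∈ with l , _ , refl , _ ← steinitz d c indep c∈ = ℕ.m≤m+n _ l

-- Limits of sequences in saturated structures.

Eventually : (ℕ → Set ℓ) → Set ℓ
Eventually P = ∃[ N ] ∀ i → N ℕ.≤ i → P i

eventually-× : {P : ℕ → Set ℓ₂} {Q : ℕ → Set ℓ₃} → Eventually P → Eventually Q → Eventually (λ i → P i × Q i)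
eventually-× (N , P) (N′ , Q) = N ℕ.⊔ N′ , λ i h →
  P i (ℕ.≤-trans (ℕ.m≤m⊔n N N′) h) , Q i (ℕ.≤-trans (ℕ.m≤n⊔m N N′) h)

maybe-countable : {I : Set ℓ} → I ↣ ℕ → Maybe I ↣ ℕ
maybe-countable {I = I} I↣ℕ = mk↣ {to = code} injective
  where
  code : Maybe I → ℕ
  code = maybe′ (suc ∘ Injection.to I↣ℕ) 0
  injective : ∀ {i j} → code i ≡ code j → i ≡ j
  injective {just _}  {just _}  eq = cong just (Injection.injective I↣ℕ (ℕ.suc-injective eq))
  injective {nothing} {nothing} _  = refl

ℕ×Fin↣ℕ : ∀ n → (ℕ × Fin n) ↣ ℕ
ℕ×Fin↣ℕ n = mk↣ {to = λ (i , x) → i * n + Fin.toℕ x} injective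
  where
  smaller : ∀ {i j} (x y : Fin n) → i ℕ.< j → i * n + Fin.toℕ x ℕ.< j * n + Fin.toℕ y
  smaller {i} {j} x y i<j = begin-strict
    i * n + Fin.toℕ x <⟨ ℕ.+-monoʳ-< (i * n) (toℕ<n x) ⟩
    i * n + n     ≡⟨ ℕ.+-comm (i * n) n ⟩
    suc i * n     ≤⟨ ℕ.*-monoˡ-≤ n i<j ⟩
    j * n         ≤⟨ ℕ.m≤m+n (j * n) (Fin.toℕ y) ⟩
    j * n + Fin.toℕ y ∎
    where open ℕ.≤-Reasoning
  injective : ∀ {ix jy : ℕ × Fin n} → proj₁ ix * n + Fin.toℕ (proj₂ ix) ≡ proj₁ jy * n + Fin.toℕ (proj₂ jy) → ix ≡ jy
  injective {i , x} {j , y} eq with ℕ.<-cmp i j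
  ... | tri< i<j _ _ = contradiction eq (ℕ.<⇒≢ (smaller x y i<j))
  ... | tri≈ _ refl _ = cong (i ,_) (toℕ-injective (ℕ.+-cancelˡ-≡ (i * n) _ _ eq))
  ... | tri> _ _ j<i = contradiction (sym eq) (ℕ.<⇒≢ (smaller y x j<i))

-- Every sequence of tuples converges to a type over any countable set of
-- parameters, and such types are realised.
HasLimits : {L : Language ℓ} → Structure L → Set (lsuc ℓ)
HasLimits {ℓ} M = ∀ {p q} (a : ℕ → Vec (Carrier M) p) (z : Vec (Carrier M) q) → ∃[ x ]
  ∀ {k} {w : Vec (Carrier M) k} → All (λ u → (∃[ i ] u ∈ᵛ a i) ⊎ u ∈ᵛ z) w →
  {Q : Vec (Carrier M) p → Set ℓ} → Definable M (λ x → x ++ w) Q → Eventually (Q ∘ a) → Q x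

module Saturation (em : Classical) {L : Language ℓ} (M : Structure L) (κ : Set ℓ)
  (κ-large : Symbols L ≺ κ) (saturated : IsSaturated M κ) where

  private
    C = Carrier M

  ℕ↣Symbols : ℕ ↣ Symbols L
  ℕ↣Symbols = mk↣ {to = inj₁} λ { refl → refl }

  -- `Symbols L` contains a copy of the natural numbers, so a κ that exceeds it is uncountable.
  countable-≺κ : {I : Set ℓ} → I ↣ ℕ → I ≺ κ
  countable-≺κ I↣ℕ =
    proj₁ κ-large ↣-∘ (ℕ↣Symbols ↣-∘ I↣ℕ) , λ κ↣I → proj₂ κ-large (ℕ↣Symbols ↣-∘ (I↣ℕ ↣-∘ κ↣I))

  DefinableOver : {I : Set ℓ} → (I → C) → (Vec C n → Set ℓ) → Set ℓ
  DefinableOver {n} {I} c P = Σ[ k ∈ ℕ ] Σ[ w ∈ Vec I k ] Definable M {E = Vec C n} (λ x → x ++ map c w) P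

  ∃ᴰˢ : ∀ k {E : Set ℓ₁} {κ : E → Vec C n} {P : E → Vec C k → Set ℓ₂} →
        Definable M {E = Vec C k × E} (λ (z , x) → z ++ κ x) (λ (z , x) → P x z) →
        Definable M κ (λ x → ∃ (P x))
  ∃ᴰˢ zero Pᴰ = imapᴰ (λ x → mk⇔ (λ Px → [] , Px) (λ { ([] , Px) → Px })) (_∘ᴰ_ {g = λ x → [] , x} Pᴰ idᵀ)
  ∃ᴰˢ (suc k) {κ = κ} Pᴰ = imapᴰ
    (λ x → mk⇔ (λ (z , y , Pyz) → y ∷ z , Pyz) (λ { (y ∷ z , Pyz) → z , y , Pyz }))
    (∃ᴰˢ k (∃ᴰ em (_∘ᴰ_ {g = λ (y , z , x) → y ∷ z , x} Pᴰ idᵀ)))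

  _×ᴼ_ : {I : Set ℓ} {c : I → C} {P Q : Vec C n → Set ℓ} →
         DefinableOver c P → DefinableOver c Q → DefinableOver c (λ x → P x × Q x)
  _×ᴼ_ {n = n} {c = c} (k , v , Pᴰ) (l , w , Qᴰ) = k + l , v ++ w ,
    subst (λ u → Definable M (λ x → x ++ u) _) (sym (map-++ c v w))
      (_×ᴰ_ em (Pᴰ ∘ᴰ (x ++ᵀ ++⁻ˡ k vw)) (Qᴰ ∘ᴰ (x ++ᵀ ++⁻ʳ k {f = λ _ → map c v} vw)))
    where
    κ′ = λ (x : Vec C n) → x ++ (map c v ++ map c w)
    x : TermFuns M κ′ id
    x = ++⁻ˡ n idᵀ
    vw : TermFuns M κ′ (λ _ → map c v ++ map c w)
    vw = ++⁻ʳ n {f = id} idᵀ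

  -- Coordinates are realised one at a time: the type of the first one says
  -- that the remaining ones exist.
  realise : ∀ n {I : Set ℓ} → I ↣ ℕ → (c : I → C) {J : Set ℓ} (P : J → Vec C n → Set ℓ) →
    (∀ j → DefinableOver c (P j)) → (∀ i j → Σ[ h ∈ J ] ∀ x → P h x → P i x × P j x) →
    J → (∀ j → ∃ (P j)) → ∃[ x ] ∀ j → P j x
  realise zero _ c P _ _ _ sat = [] , λ j → P[] (sat j)
    where
    P[] : ∀ {j} → ∃ (P j) → P j []
    P[] ([] , Px) = Px
  realise (suc n) {I} I↣ℕ c {J} P Pᴰ directed j₀ sat = conclude (saturated I c (countable-≺κ I↣ℕ) type finitely)
    where
    first : ∀ j → let k , w , _ = Pᴰ j in Definable M {E = C} (λ x → x ∷ map c w) (λ x → ∃[ z ] P j (x ∷ z))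
    first j with k , w , Pjᴰ ← Pᴰ j = ∃ᴰˢ n (_∘ᴰ_ {g = λ (z , x) → x ∷ z} Pjᴰ
      (headᵀ xw ∷ᵀ (++⁻ˡ n idᵀ ++ᵀ tailᵀ xw)))
      where
      xw : TermFuns M (λ ((z , x) : Vec C n × C) → z ++ x ∷ map c w) (λ (z , x) → x ∷ map c w)
      xw = ++⁻ʳ n {f = proj₁} idᵀ

    code : J → Σ[ k ∈ ℕ ] Formula L (suc k) × Vec I k
    code j = let k , w , _ = Pᴰ j in k , formula (first j) , w

    type : Pred (Σ[ k ∈ ℕ ] Formula L (suc k) × Vec I k) ℓ
    type χ = ∃[ j ] code j ≡ χ

    Sat : C → Σ[ k ∈ ℕ ] Formula L (suc k) × Vec I k → Set ℓ
    Sat = λ { x (k , φ , w) → M ⊨ φ [ x ∷ map c w ] }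

    bound : ∀ Φ → Allᴸ type Φ → Σ[ j ∈ J ] ∀ x → (∃[ z ] P j (x ∷ z)) → Allᴸ (Sat x) Φ
    bound [] [] = j₀ , λ _ _ → []
    bound (_ ∷ Φ) ((i , refl) ∷ Φ∈) with j , Pj⇒Φ ← bound Φ Φ∈ with h , Ph⇒ ← directed i j =
      h , λ x (z , Phz) → from (⊨-formula (first i) x) (z , proj₁ (Ph⇒ _ Phz)) ∷ Pj⇒Φ x (z , proj₂ (Ph⇒ _ Phz))

    finitely : ∀ Φ → Allᴸ type Φ → ∃[ x ] Allᴸ (Sat x) Φ
    finitely Φ Φ∈ with j , Pj⇒Φ ← bound Φ Φ∈ with (x ∷ z , Pxz) ← sat j = x , Pj⇒Φ x (z , Pxz)

    conclude : (∃[ x ] ∀ χ → type χ → Sat x χ) → ∃[ x ] ∀ j → P j x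
    conclude (x , x⊨) = let
        z , Pxz = realise n (maybe-countable I↣ℕ) (maybe′ c x) (λ j → P j ∘ (x ∷_)) rest
          (λ i j → proj₁ (directed i j) , λ z → proj₂ (directed i j) (x ∷ z)) j₀
          (λ j → to (⊨-formula (first j) x) (x⊨ (code j) (j , refl)))
      in x ∷ z , Pxz
      where
      rest : ∀ j → DefinableOver (maybe′ c x) (P j ∘ (x ∷_))
      rest j with k , w , Pjᴰ ← Pᴰ j = suc k , nothing ∷ map just w ,
        subst (λ u → Definable M (λ z → z ++ x ∷ u) _) (map-∘ (maybe′ c x) just w)
          (_∘ᴰ_ {g = x ∷_} Pjᴰ (headᵀ xw ∷ᵀ (++⁻ˡ n idᵀ ++ᵀ tailᵀ xw)))
        where
        xw : TermFuns M (λ (z : Vec C n) → z ++ x ∷ map c w) (λ z → x ∷ map c w)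
        xw = ++⁻ʳ n {f = id} idᵀ

  limit : HasLimits M
  limit {p} {q} a z = conclude (realise p I↣ℕ c Holds holdsᴰ directed ⊤ʲ satisfied)
    where
    I : Set ℓ
    -- A parameter is coded by an index i and a position in `a i ++ z`; thus z recurs for every i,
    -- and codes need not be unique.
    I = Lift ℓ (ℕ × Fin (p + q))
    I↣ℕ : I ↣ ℕ
    I↣ℕ = ℕ×Fin↣ℕ (p + q) ↣-∘ mk↣ {to = Lift.lower} λ { refl → refl }
    c : I → C
    c (lift (i , x)) = lookup (a i ++ z) x
    J : Set ℓ
    J = Σ[ k ∈ ℕ ] Σ[ w ∈ Vec I k ] Σ[ φ ∈ Formula L (p + k) ] Eventually (λ i → M ⊨ φ [ a i ++ map c w ])
    Holds : J → Vec C p → Set ℓ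
    Holds (k , w , φ , _) x = M ⊨ φ [ x ++ map c w ]
    holdsᴰ : ∀ j → DefinableOver c (Holds j)
    holdsᴰ (k , w , φ , _) = k , w , ⊨ᴰ φ idᵀ
    directed : ∀ i j → Σ[ h ∈ J ] ∀ x → Holds h x → Holds i x × Holds j x
    directed i@(_ , _ , _ , φ) j@(_ , _ , _ , ψ)
      with k , w , χ ← holdsᴰ i ×ᴼ holdsᴰ j | N , both ← eventually-× φ ψ =
      (k , w , formula χ , N , λ i h → from (⊨-formula χ (a i)) (both i h)) , λ x → to (⊨-formula χ x)
    -- A true formula, which serves as the bound for the empty set of formulas.
    ⊤ʲ : J
    ⊤ʲ = 0 , [] , (⊥̇ ⇒ ⊥̇) , 0 , λ _ _ → id
    satisfied : ∀ j → ∃ (Holds j)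
    satisfied (_ , _ , _ , N , h) = a N , h N ℕ.≤-refl
    code : ∀ {u} → (∃[ i ] u ∈ᵛ a i) ⊎ u ∈ᵛ z → Σ[ i ∈ I ] c i ≡ u
    code (inj₁ (i , u∈)) = lift (i , Any.index (∈-++⁺ˡ u∈)) , sym (Any.lookup-index (∈-++⁺ˡ u∈))
    code (inj₂ u∈) = lift (0 , Any.index (∈-++⁺ʳ (a 0) u∈)) , sym (Any.lookup-index (∈-++⁺ʳ (a 0) u∈))
    codes : ∀ {k} {w : Vec C k} → All (λ u → (∃[ i ] u ∈ᵛ a i) ⊎ u ∈ᵛ z) w → Σ[ v ∈ Vec I k ] map c v ≡ w
    codes [] = [] , refl
    codes (u ∷ w) with i , eq ← code u | v , eqs ← codes w = i ∷ v , cong₂ _∷_ eq eqs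
    conclude : (∃[ x ] ∀ j → Holds j x) → ∃[ x ]
      ∀ {k} {w : Vec C k} → All (λ u → (∃[ i ] u ∈ᵛ a i) ⊎ u ∈ᵛ z) w →
      {Q : Vec C p → Set ℓ} → Definable M (λ x → x ++ w) Q → Eventually (Q ∘ a) → Q x
    conclude (x , Px) = x , λ w∈ Qᴰ (N , Qa) → let v , v≡ = codes w∈ in
      to (⊨-formula Qᴰ x) (subst (λ w → M ⊨ formula Qᴰ [ x ++ w ]) v≡
        (Px (_ , v , formula Qᴰ , N , λ i h →
          subst (λ w → M ⊨ formula Qᴰ [ a i ++ w ]) (sym v≡) (from (⊨-formula Qᴰ (a i)) (Qa i h)))))

-- Increasing index tuples and eventual indiscernibility.

blocks : {C : Set ℓ} → (ℕ → Vec C n) → Vec ℕ k → Vec C (k * n)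
blocks a is = concat (map a is)

module _ {L : Language ℓ} {A : Structure L} {p : ℕ} (a : ℕ → Vec (Carrier A) p) where

  blocks-++⁻ˡ : ∀ k → TermFuns A {E = Vec ℕ k × Vec ℕ l} (λ (is , js) → blocks a (is ++ js)) (λ (is , js) → blocks a is)
  blocks-++⁻ˡ zero = [] , λ { ([] , _) → refl }
  blocks-++⁻ˡ {l} (suc k) = terms split , λ { (i ∷ is , js) → evals-terms split (i , is , js) }
    where
    split : TermFuns A {E = ℕ × Vec ℕ k × Vec ℕ l}
      (λ (i , is , js) → a i ++ blocks a (is ++ js)) (λ (i , is , js) → a i ++ blocks a is)
    split = _++ᵀ_ {f = λ (i , _) → a i} {g = λ (_ , is , _) → blocks a is} (++⁻ˡ p idᵀ)
      (_∘ᵀˢ_ {g = proj₂} (blocks-++⁻ˡ {l} k) (++⁻ʳ p {f = λ (i , _) → a i} idᵀ))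

  blocks-++⁻ʳ : ∀ k → TermFuns A {E = Vec ℕ k × Vec ℕ l} (λ (is , js) → blocks a (is ++ js)) (λ (is , js) → blocks a js)
  blocks-++⁻ʳ {l} zero = terms js , λ { ([] , is) → evals-terms js is }
    where
    js : TermFuns A {E = Vec ℕ l} (blocks a) (blocks a)
    js = idᵀ
  blocks-++⁻ʳ {l} (suc k) = terms split , λ { (i ∷ is , js) → evals-terms split (i , is , js) }
    where
    split : TermFuns A {E = ℕ × Vec ℕ k × Vec ℕ l}
      (λ (i , is , js) → a i ++ blocks a (is ++ js)) (λ (i , is , js) → blocks a js)
    split = _∘ᵀˢ_ {g = proj₂} (blocks-++⁻ʳ {l} k) (++⁻ʳ p {f = λ (i , _) → a i} idᵀ)

Above : ℕ → Vec ℕ k → Set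
Above N is = Linked ℕ._<_ (N ∷ is)

above-mono : ∀ {M N} {is : Vec ℕ k} → M ℕ.≤ N → Above N is → Above M is
above-mono M≤N [-]       = [-]
above-mono M≤N (N<i ∷ h) = ℕ.≤-<-trans M≤N N<i ∷ h

above⇒linked : ∀ {N} {is : Vec ℕ k} → Above N is → Linked ℕ._<_ is
above⇒linked [-]     = []
above⇒linked (_ ∷ h) = h

last : ℕ → Vec ℕ k → ℕ
last N []       = N
last N (i ∷ is) = last i is

above-++ : ∀ {N} (is : Vec ℕ k) {js : Vec ℕ l} → Above N is → Above (last N is) js → Above N (is ++ js)
above-++ []       _         h = h
above-++ (i ∷ is) (N<i ∷ g) h = N<i ∷ above-++ is g h

upFrom : ∀ k → ℕ → Vec ℕ k
upFrom zero    N = []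
upFrom (suc k) N = suc N ∷ upFrom k (suc N)

above-upFrom : ∀ k N → Above N (upFrom k N)
above-upFrom zero    N = [-]
above-upFrom (suc k) N = ℕ.≤-refl ∷ above-upFrom k (suc N)

EventuallyConstant : (Vec ℕ k → Set ℓ) → Set ℓ
EventuallyConstant P = ∃[ N ] ((∀ is → Above N is → P is) ⊎ (∀ is → Above N is → ¬ P is))

-- The bound may depend on the formula. Dependence is the case k = 1; larger k is what allows
-- parameters to be added one at a time, because comparing two tuples of indices needs a formula in
-- both.
EventuallyIndiscernible : {L : Language ℓ} (A : Structure L) → (ℕ → Vec (Carrier A) n) → Vec (Carrier A) m → Set ℓ
EventuallyIndiscernible {n = n} {m} {L} A a b =
  ∀ k (φ : Formula L (k * n + m)) → EventuallyConstant (λ (is : Vec ℕ k) → A ⊨ φ [ blocks a is ++ b ])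

∈-concat : {C : Set ℓ} (a : ℕ → Vec C n) (is : Vec ℕ k) → All (λ u → ∃[ i ] u ∈ᵛ a i) (blocks a is)
∈-concat a is = All.concat⁺ (All.map⁺ (All.universal (λ i → All.lookup⁻ λ x → i , ∈-lookup x (a i)) is))

-- Dependence of formulas in o-minimal structures.

module NIP (em : Classical) {L : Language ℓ} (S : HasOrderedGroupSymbols L) (A : Structure L)
  (isSTO : IsStrictTotalOrder _≡_ (less S A)) (omin : IsOMinimal S A) (limit : HasLimits A) where

  open OMinimal em S A isSTO omin

  private
    C = Carrier A

  module _ {n m} {a : ℕ → Vec C n} {b : Vec C m} (ind : EventuallyIndiscernible A a b) where

    -- Upwards closed sets are linearly ordered by inclusion, so that along
    -- an indiscernible sequence they form a chain.
    upwards-constant : {U : Vec ℕ k → C → Set ℓ} →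
      Definable A (λ ((u , is) : C × Vec ℕ k) → u ∷ blocks a is ++ b) (λ (u , is) → U is u) →
      (∀ is {x y} → x ≤ y → U is x → U is y) → ∀ y → EventuallyConstant (λ is → U is y)
    upwards-constant {k} {U} Uᴰ up y = conclude (ind (k + k) (formula ⊆ᴰ))
      where
      κ : Vec ℕ k × Vec ℕ k → Vec C ((k + k) * n + m)
      κ (is , js) = blocks a (is ++ js) ++ b
      κ′ : C × Vec ℕ k × Vec ℕ k → Vec C (suc ((k + k) * n + m))
      κ′ (u , e) = u ∷ κ e
      isjs : TermFuns A κ′ (λ (_ , is , js) → blocks a (is ++ js))
      isjs = ++⁻ˡ ((k + k) * n) (tailᵀ idᵀ)
      bᵀ : TermFuns A κ′ (λ _ → b)
      bᵀ = ++⁻ʳ ((k + k) * n) {f = λ (_ , is , js) → blocks a (is ++ js)} (tailᵀ idᵀ)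
      ⊆ᴰ : Definable A κ (λ (is , js) → ∀ u → U is u → U js u)
      ⊆ᴰ = ∀ᴰ ((_∘ᴰ_ {g = λ (u , is , js) → u , is} Uᴰ
                  (headᵀ idᵀ ∷ᵀ _∘ᵀˢ_ {g = proj₂} (blocks-++⁻ˡ a k) isjs ++ᵀ bᵀ))
            →ᴰ (_∘ᴰ_ {g = λ (u , is , js) → u , js} Uᴰ
                  (headᵀ idᵀ ∷ᵀ _∘ᵀˢ_ {g = proj₂} (blocks-++⁻ʳ a k) isjs ++ᵀ bᵀ)))
      conclude : EventuallyConstant (λ v → A ⊨ formula ⊆ᴰ [ blocks a v ++ b ]) → EventuallyConstant (λ is → U is y)
      conclude (N , inj₁ always) with em {P = ∃[ is ] Above N is × U is y}
      ... | yes (is , N<is , Uy) = last N is , inj₁ λ js is<js →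
        to (⊨-formula ⊆ᴰ (is , js)) (always (is ++ js) (above-++ is N<is is<js)) y Uy
      ... | no ∄ = N , inj₂ λ is N<is Uy → ∄ (is , N<is , Uy)
      conclude (N , inj₂ never) with em {P = ∃[ is ] Above N is × ¬ U is y}
      ... | no ∄ = N , inj₁ λ is N<is → ¬¬-elim {A = A} em λ ¬Uy → ∄ (is , N<is , ¬Uy)
      ... | yes (is , N<is , ¬Uy) = last N is , inj₂ λ js is<js Uy →
        -- A later set containing y, which `U is` misses, would by linearity include `U is`.
        never (is ++ js) (above-++ is N<is is<js) (from (⊨-formula ⊆ᴰ (is , js)) λ u Uu →
          case u ≤ᵇ y of λ where
            (inj₁ u≤y) → contradiction (up is u≤y Uu) ¬Uy
            (inj₂ y<u) → up js (<⇒≤ y<u) Uy)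

    -- Membership of y is decided by how often `X` is entered and left below y, and each such count
    -- is upwards closed in y, hence eventually constant. Some count eventually fails: otherwise all
    -- of them would pass to a limit of the tuples, whose single definable set has boundedly many
    -- alternations.
    indiscernible-∷ : ∀ y → EventuallyIndiscernible A a (y ∷ b)
    indiscernible-∷ y k φ = by-cases em
      where
      E = Vec C (k * n) × Vec C m
      X : E → C → Set ℓ
      X (v , b) u = A ⊨ φ [ v ++ u ∷ b ]

      Xᴰ : Definable A (λ ((u , v , b) : C × E) → u ∷ v ++ b) (λ (u , e) → X e u)
      Xᴰ = ⊨ᴰ φ (++⁻ˡ (k * n) (tailᵀ idᵀ) ++ᵀ headᵀ idᵀ ∷ᵀ ++⁻ʳ (k * n) {f = λ (_ , v , b) → v} (tailᵀ idᵀ))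

      at : Vec ℕ k → E
      at is = blocks a is , b

      leaves-constant : ∀ j → EventuallyConstant (λ is → Leaves (X (at is)) j y)
      leaves-constant j = upwards-constant
        (_∘ᴰ_ {g = λ (u , is) → u , at is} (leavesᴰ Xᴰ j) idᵀ) (λ _ → leaves-up j) y

      enters-constant : ∀ j → EventuallyConstant (λ is → Enters (X (at is)) j y)
      enters-constant j = upwards-constant
        (_∘ᴰ_ {g = λ (u , is) → u , at is} (entersᴰ Xᴰ j) idᵀ) (λ _ → enters-up j) y

      run : ∀ j {N} → (∀ is → Above N is → ¬ Leaves (X (at is)) j y) → EventuallyConstant (λ is → X (at is) y)
      run zero {N} never = contradiction tt (never (upFrom k N) (above-upFrom k N))
      -- At the largest count that is eventually reached, lying in `X` is equivalent to `Enters`.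
      run (suc j) {N} never with leaves-constant j
      ... | _ , inj₂ never′ = run j never′
      ... | M , inj₁ always with enters-constant j
      ...   | O , inj₁ enters = N ℕ.⊔ O , inj₁ λ is h → run-⊆ j
        ( enters is (above-mono (ℕ.m≤n⊔m N O) h) , never is (above-mono (ℕ.m≤m⊔n N O) h))
      ...   | O , inj₂ ¬enters = M ℕ.⊔ O , inj₂ λ is h Xy → ¬enters is (above-mono (ℕ.m≤n⊔m M O) h)
        (y , ≤-refl , always is (above-mono (ℕ.m≤m⊔n M O) h) , Xy)

      by-cases : Dec (∃[ j ] ∃[ N ] (∀ is → Above N is → ¬ Leaves (X (at is)) j y)) →
                 EventuallyConstant (λ is → X (at is) y)
      by-cases (yes (j , _ , never)) = run j never
      by-cases (no ∄) with limit (λ i → blocks a (upFrom k i)) (y ∷ b)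
      ... | v , v-limit = contradiction (v-limit {w = y ∷ b} (All.map inj₂ (All.lookup⁻ λ i → ∈-lookup i (y ∷ b)))
            (_∘ᴰ_ {g = λ v → y , v , b} (leavesᴰ Xᴰ K) (headᵀ yb ∷ᵀ ++⁻ˡ (k * n) idᵀ ++ᵀ tailᵀ yb))
            (eventually (leaves-constant K))) (proj₂ bounded y)
        where
        bounded = leaves-bounded Xᴰ (v , b)
        K = proj₁ bounded
        yb : TermFuns A (λ (v : Vec C (k * n)) → v ++ y ∷ b) (λ _ → y ∷ b)
        yb = ++⁻ʳ (k * n) {f = id} idᵀ
        eventually : EventuallyConstant (λ is → Leaves (X (at is)) K y) →
                     Eventually (λ i → Leaves (X (at (upFrom k i))) K y)
        eventually (N , inj₁ always) = N , λ i N≤i → always _ (above-mono N≤i (above-upFrom k i))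
        eventually (N , inj₂ never) = contradiction (K , N , never) ∄

  indiscernible-++ : ∀ {n m} {a : ℕ → Vec C n} (b : Vec C m) →
                     EventuallyIndiscernible A a [] → EventuallyIndiscernible A a b
  indiscernible-++ []      ind = ind
  indiscernible-++ (y ∷ b) ind = indiscernible-∷ (indiscernible-++ b ind) y

-- From the language without `𝔣` to the language with it.

module _ {L : Language ℓ} where

  embed  : Term L n → Term (L ⟨𝔣⟩) n
  embed* : Vec (Term L n) k → Vec (Term (L ⟨𝔣⟩) n) k
  embed (var i)    = var i
  embed (app F ts) = app (old F) (embed* ts)
  embed* []       = []
  embed* (t ∷ ts) = embed t ∷ embed* ts

  embedF : Formula L n → Formula (L ⟨𝔣⟩) n
  embedF (s ≐ t)    = embed s ≐ embed t
  embedF (rel R ts) = rel R (embed* ts)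
  embedF ⊥̇          = ⊥̇
  embedF (φ ⇒ ψ)    = embedF φ ⇒ embedF ψ
  embedF (∀̇ φ)      = ∀̇ embedF φ

  module _ {M : Structure (L ⟨𝔣⟩)} where

    eval-embed   : (v : Vec (Carrier M) n) (t : Term L n) → eval M v (embed t) ≡ eval (reduct M) v t
    evals-embed* : (v : Vec (Carrier M) n) (ts : Vec (Term L n) k) → evals M v (embed* ts) ≡ evals (reduct M) v ts
    eval-embed v (var i)    = refl
    eval-embed v (app F ts) = cong (fun M (old F)) (evals-embed* v ts)
    evals-embed* v []       = refl
    evals-embed* v (t ∷ ts) = cong₂ _∷_ (eval-embed v t) (evals-embed* v ts)

    ⊨-embedF : (φ : Formula L n) (v : Vec (Carrier M) n) → M ⊨ embedF φ [ v ] ⇔ reduct M ⊨ φ [ v ]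
    ⊨-embedF (s ≐ t) v rewrite eval-embed v s | eval-embed v t = ⇔.refl
    ⊨-embedF (rel R ts) v rewrite evals-embed* v ts = ⇔.refl
    ⊨-embedF ⊥̇ v = ⇔.refl
    ⊨-embedF (φ ⇒ ψ) v = mk⇔ (λ h → to ψ⇔ ∘ h ∘ from φ⇔) (λ h → from ψ⇔ ∘ h ∘ to φ⇔)
      where
      φ⇔ = ⊨-embedF φ v
      ψ⇔ = ⊨-embedF ψ v
    ⊨-embedF (∀̇ φ) v = mk⇔ (λ h x → to (⊨-embedF φ (x ∷ v)) (h x)) (λ h x → from (⊨-embedF φ (x ∷ v)) (h x))

    module _ {E : Set ℓ₁} {κ : E → Vec (Carrier M) n} where

      embedᵀ : {f : E → Carrier M} → TermFun (reduct M) κ f → TermFun M κ f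
      embedᵀ (t , t≡) = embed t , λ x → trans (eval-embed (κ x) t) (t≡ x)

      embedᴰ : {P : E → Set ℓ₂} → Definable (reduct M) κ P → Definable M κ P
      embedᴰ (φ , φ⇔) = embedF φ , λ x → ⇔.trans (⊨-embedF φ (κ x)) (φ⇔ x)

    reduct-limits : HasLimits M → HasLimits (reduct M)
    reduct-limits limit a z with x , x-limit ← limit a z = x , λ w∈ Qᴰ → x-limit w∈ (embedᴰ Qᴰ)

-- Indiscernibility over parameters.

prefixLength : ℕ → ℕ → ℕ → ℕ
prefixLength p zero    m = m
prefixLength p (suc N) m = prefixLength p N (p + m)

-- The recursion accumulates in e, so that it matches N applications of `indiscernible-shift`; the
-- blocks end up in reverse order, `a 0` next to e.
prefix : {C : Set ℓ} → ∀ {p} N → (ℕ → Vec C p) → Vec C m → Vec C (prefixLength p N m)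
prefix zero    a e = e
prefix (suc N) a e = prefix N (a ∘ suc) (a 0 ++ e)

prefix-∈ʳ : {C : Set ℓ} {x : C} → ∀ {p} N {a : ℕ → Vec C p} {e : Vec C m} → x ∈ᵛ e → x ∈ᵛ prefix N a e
prefix-∈ʳ zero    x∈ = x∈
prefix-∈ʳ (suc N) {a} x∈ = prefix-∈ʳ N (∈-++⁺ʳ (a 0) x∈)

prefix-∈ˡ : {C : Set ℓ} {x : C} → ∀ {p i} N {a : ℕ → Vec C p} {e : Vec C m} → i ℕ.< N → x ∈ᵛ a i → x ∈ᵛ prefix N a e
prefix-∈ˡ {i = zero}  (suc N) _ x∈ = prefix-∈ʳ N (∈-++⁺ˡ x∈)
prefix-∈ˡ {i = suc i} (suc N) (ℕ.s≤s i<N) x∈ = prefix-∈ˡ N i<N x∈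

all-prefix : {C : Set ℓ} {P : Pred C ℓ} → ∀ {p} N {a : ℕ → Vec C p} {e : Vec C m} →
  (∀ i → All P (a i)) → All P e → All P (prefix N a e)
all-prefix zero    _  Pe = Pe
all-prefix (suc N) Pa Pe = all-prefix N (Pa ∘ suc) (All.++⁺ (Pa 0) Pe)

module _ {L : Language ℓ} {M : Structure L} where

  private
    C = Carrier M

  IndiscernibleOver : ∀ {p} → (ℕ → Vec C p) → Vec C m → Set ℓ
  IndiscernibleOver {m} {p} a e = ∀ {k} (φ : Formula L (k * p + m)) (is js : Vec ℕ k) →
    Linked ℕ._<_ is → Linked ℕ._<_ js → M ⊨ φ [ blocks a is ++ e ] → M ⊨ φ [ blocks a js ++ e ]

  indiscernible-over-[] : ∀ {p} {a : ℕ → Vec C p} → IsIndiscernible M a → IndiscernibleOver a []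
  indiscernible-over-[] {p} ind {k} φ is js li lj h =
    to (⊨-formula φᴰ _) (to (ind (formula φᴰ) is js li lj) (from (⊨-formula φᴰ _) h))
    where
    φᴰ : Definable M {E = Vec C (k * p)} id (λ v → M ⊨ φ [ v ++ [] ])
    φᴰ = ⊨ᴰ φ (idᵀ ++ᵀ []ᵀ)

  indiscernible-eventually : ∀ {p} (em : Classical) {a : ℕ → Vec C p} {e : Vec C m} →
    IndiscernibleOver a e → EventuallyIndiscernible M a e
  indiscernible-eventually em {a} {e} ind k φ with em {P = M ⊨ φ [ blocks a (upFrom k 0) ++ e ]}
  ... | yes φ₀ = 0 , inj₁ λ is 0<is → ind φ _ is (above⇒linked (above-upFrom k 0)) (above⇒linked 0<is) φ₀
  ... | no ¬φ₀ = 0 , inj₂ λ is 0<is φᵢ →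
    ¬φ₀ (ind φ is _ (above⇒linked 0<is) (above⇒linked (above-upFrom k 0)) φᵢ)

  -- Index 0 lies below all shifted indices, so `a 0` can be read as the first block of a longer
  -- increasing tuple.
  indiscernible-shift : ∀ {p} {a : ℕ → Vec C p} {e : Vec C m} →
    IndiscernibleOver a e → IndiscernibleOver (a ∘ suc) (a 0 ++ e)
  indiscernible-shift {m} {p} {a} {e} ind {k} φ is js li lj h
    rewrite map-∘ a suc is | map-∘ a suc js =
    to (⊨-formula φᴰ (a 0 , _ , e))
      (ind (formula φᴰ) (0 ∷ map suc is) (0 ∷ map suc js) (shifted li) (shifted lj)
        (from (⊨-formula φᴰ (a 0 , _ , e)) h))
    where
    E = Vec C p × Vec C (k * p) × Vec C m
    κ : E → Vec C ((p + k * p) + m)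
    κ (x , v , e) = (x ++ v) ++ e
    xv : TermFuns M κ (λ (x , v , e) → x ++ v)
    xv = ++⁻ˡ (p + k * p) idᵀ
    φᴰ : Definable M κ (λ (x , v , e) → M ⊨ φ [ v ++ (x ++ e) ])
    φᴰ = ⊨ᴰ φ (++⁻ʳ p {f = proj₁} xv ++ᵀ (++⁻ˡ p xv ++ᵀ ++⁻ʳ (p + k * p) {f = λ (x , v , e) → x ++ v} idᵀ))
    shifted : {is : Vec ℕ n} → Linked ℕ._<_ is → Linked ℕ._<_ (0 ∷ map suc is)
    shifted []       = [-]
    shifted [-]      = ℕ.s≤s ℕ.z≤n ∷ [-]
    shifted {is = i ∷ j ∷ is} (i<j ∷ li) with _ ∷ li′ ← shifted li = ℕ.s≤s ℕ.z≤n ∷ ℕ.s≤s i<j ∷ li′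

  indiscernible-prefix : ∀ {p} N {a : ℕ → Vec C p} {e : Vec C m} →
    IndiscernibleOver a e → IndiscernibleOver (λ i → a (N + i)) (prefix N a e)
  indiscernible-prefix zero    ind = ind
  indiscernible-prefix (suc N) ind = indiscernible-prefix N (indiscernible-shift ind)

  module _ {p q} {a : ℕ → Vec C p} {y : Vec C m} {G : Vec C p → Vec C q} (Gᵀ : TermFuns M (λ x → x ++ y) G) where

    blocksᵀ : ∀ k → TermFuns M {E = Vec ℕ k} (λ is → blocks a is ++ y) (blocks (G ∘ a))
    blocksᵀ zero = [] , λ { [] → refl }
    blocksᵀ (suc k) = terms both , λ { (i ∷ is) → evals-terms both (i , is) }
      where
      κ : ℕ × Vec ℕ k → Vec C ((p + k * p) + m)
      κ (i , is) = (a i ++ blocks a is) ++ y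
      aᵀ : TermFuns M κ (λ (i , is) → a i ++ blocks a is)
      aᵀ = ++⁻ˡ (p + k * p) idᵀ
      yᵀ : TermFuns M κ (λ _ → y)
      yᵀ = ++⁻ʳ (p + k * p) {f = λ (i , is) → a i ++ blocks a is} idᵀ
      both : TermFuns M κ (λ (i , is) → G (a i) ++ blocks (G ∘ a) is)
      both = _++ᵀ_ {f = λ (i , _) → G (a i)} {g = λ (_ , is) → blocks (G ∘ a) is}
        (_∘ᵀˢ_ {g = λ (i , is) → a i} Gᵀ (++⁻ˡ p aᵀ ++ᵀ yᵀ))
        (_∘ᵀˢ_ {g = proj₂} (blocksᵀ k) (++⁻ʳ p {f = λ (i , _) → a i} aᵀ ++ᵀ yᵀ))

    indiscernible-image : IndiscernibleOver a y → IsIndiscernible M (G ∘ a)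
    indiscernible-image ind {k} φ is js li lj = mk⇔ (transfer is js li lj) (transfer js is lj li)
      where
      φᴰ : Definable M {E = Vec ℕ k} (λ is → blocks a is ++ y) (λ is → M ⊨ φ [ blocks (G ∘ a) is ])
      φᴰ = ⊨ᴰ φ (blocksᵀ k)
      transfer : ∀ is js → Linked ℕ._<_ is → Linked ℕ._<_ js →
                 M ⊨ φ [ blocks (G ∘ a) is ] → M ⊨ φ [ blocks (G ∘ a) js ]
      transfer is js li lj h =
        to (⊨-formula φᴰ js) (ind (formula φᴰ) is js li lj (from (⊨-formula φᴰ is) h))

  indiscernible-cong : ∀ {p} {a b : ℕ → Vec C p} → (∀ i → a i ≡ b i) → IsIndiscernible M a → IsIndiscernible M b
  indiscernible-cong a≡b ind φ is js li lj
    rewrite sym (map-cong a≡b is) | sym (map-cong a≡b js) = ind φ is js li lj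

  linked-∷ʳ : ∀ (is : Vec ℕ k) {i} → Linked ℕ._<_ is → last 0 is ℕ.< i → Linked ℕ._<_ (is ++ i ∷ [])
  linked-∷ʳ []           []       _   = [-]
  linked-∷ʳ (_ ∷ [])     [-]      h   = h ∷ [-]
  linked-∷ʳ (_ ∷ j ∷ is) (r ∷ li) h   = r ∷ linked-∷ʳ (j ∷ is) li h

  -- A limit x of a over e can be added to the parameters, since the truth of
  -- a formula at (a_is, x, e) is that at (a_is, a_i, e) for all large i.
  indiscernible-limit : ∀ {p} {a : ℕ → Vec C p} {e : Vec C m} {x : Vec C p} →
    (∀ {k} {w : Vec C k} → All (λ u → (∃[ i ] u ∈ᵛ a i) ⊎ u ∈ᵛ e) w →
      {Q : Vec C p → Set ℓ} → Definable M (λ x → x ++ w) Q → Eventually (Q ∘ a) → Q x) →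
    IndiscernibleOver a e → IndiscernibleOver a (x ++ e)
  indiscernible-limit {m} {p} {a} {e} {x} x-limit ind {k} φ is js li lj =
    x-limit {w = blocks a is ++ (blocks a js ++ e)}
      (All.++⁺ (All.map inj₁ (∈-concat a is)) (All.++⁺ (All.map inj₁ (∈-concat a js))
        (All.lookup⁻ λ i → inj₂ (∈-lookup i e))))
      {Q = λ x → M ⊨ φ [ blocks a is ++ (x ++ e) ] → M ⊨ φ [ blocks a js ++ (x ++ e) ]}
      (⊨ᴰ φ (isᵀ ++ᵀ (xᵀ ++ᵀ eᵀ)) →ᴰ ⊨ᴰ φ (jsᵀ ++ᵀ (xᵀ ++ᵀ eᵀ)))
      -- Every i from here on can be appended to both tuples; `suc` keeps them strictly increasing,
      -- and the 0 is the value of `last` for empty ones.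
      (suc (last 0 is ℕ.⊔ last 0 js) , λ i h φis → to (⊨-formula φᴰ (js , i))
        (ind (formula φᴰ) (is ++ i ∷ []) (js ++ i ∷ [])
          (linked-∷ʳ is li (ℕ.≤-trans (ℕ.s≤s (ℕ.m≤m⊔n _ _)) h))
          (linked-∷ʳ js lj (ℕ.≤-trans (ℕ.s≤s (ℕ.m≤n⊔m (last 0 is) _)) h))
          (from (⊨-formula φᴰ (is , i)) φis)))
    where
    κₓ : Vec C p → Vec C (p + (k * p + (k * p + m)))
    κₓ x = x ++ (blocks a is ++ (blocks a js ++ e))
    xᵀ : TermFuns M κₓ id
    xᵀ = ++⁻ˡ p idᵀ
    wᵀ : TermFuns M κₓ (λ _ → blocks a is ++ (blocks a js ++ e))
    wᵀ = ++⁻ʳ p {f = id} idᵀ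
    isᵀ : TermFuns M κₓ (λ _ → blocks a is)
    isᵀ = ++⁻ˡ (k * p) wᵀ
    jseᵀ : TermFuns M κₓ (λ _ → blocks a js ++ e)
    jseᵀ = ++⁻ʳ (k * p) {f = λ _ → blocks a is} wᵀ
    jsᵀ : TermFuns M κₓ (λ _ → blocks a js)
    jsᵀ = ++⁻ˡ (k * p) jseᵀ
    eᵀ : TermFuns M κₓ (λ _ → e)
    eᵀ = ++⁻ʳ (k * p) {f = λ _ → blocks a js} jseᵀ
    κ : Vec ℕ k × ℕ → Vec C ((k + 1) * p + m)
    κ (is , i) = blocks a (is ++ i ∷ []) ++ e
    isi : TermFuns M κ (λ (is , i) → blocks a (is ++ i ∷ []))
    isi = ++⁻ˡ ((k + 1) * p) idᵀ
    φᴰ : Definable M κ (λ (is , i) → M ⊨ φ [ blocks a is ++ (a i ++ e) ])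
    φᴰ = ⊨ᴰ φ (_∘ᵀˢ_ {g = λ (is , i) → is , i ∷ []} (blocks-++⁻ˡ a k) isi
      ++ᵀ (++⁻ˡ p {g = λ _ → []} (_∘ᵀˢ_ {g = λ (is , i) → is , i ∷ []} (blocks-++⁻ʳ a k) isi)
      ++ᵀ ++⁻ʳ ((k + 1) * p) {f = λ (is , i) → blocks a (is ++ i ∷ [])} idᵀ))

module _ {L : Language ℓ} where

-- A generated element involves finitely many generators, and all of these occur from some stage on.
⟨⟩-eventually  : {L : Language ℓ} {A : Structure L} {X : Pred (Carrier A) ℓ} {s : ℕ → ℕ}
  {v : ∀ N → Vec (Carrier A) (s N)} → (∀ {x} → X x → Eventually (λ N → x ∈ᵛ v N)) →
  ∀ {x} → ⟨ A ⟩ X x → Eventually (λ N → ⟨ A ⟩ (_∈ᵛ v N) x)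
⟨⟩-eventually* : {L : Language ℓ} {A : Structure L} {X : Pred (Carrier A) ℓ} {s : ℕ → ℕ}
  {v : ∀ N → Vec (Carrier A) (s N)} → (∀ {x} → X x → Eventually (λ N → x ∈ᵛ v N)) →
  ∀ {k} {xs : Vec (Carrier A) k} → All (⟨ A ⟩ X) xs → Eventually (λ N → All (⟨ A ⟩ (_∈ᵛ v N)) xs)
⟨⟩-eventually X⊆ (gen Xx) with N , h ← X⊆ Xx = N , λ i N≤i → gen (h i N≤i)
⟨⟩-eventually X⊆ (app F xs) with N , h ← ⟨⟩-eventually* X⊆ xs = N , λ i N≤i → app F (h i N≤i)
⟨⟩-eventually* X⊆ [] = 0 , λ _ _ → []
⟨⟩-eventually* X⊆ (x ∷ xs) with N , h ← eventually-× (⟨⟩-eventually X⊆ x) (⟨⟩-eventually* X⊆ xs) =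
  N , λ i N≤i → proj₁ (h i N≤i) ∷ proj₂ (h i N≤i)

-- Capturing values of `𝔣` along an indiscernible sequence.

module Main (em : Classical) {L : Language ℓ} (S : HasOrderedGroupSymbols L) (M : Structure (L ⟨𝔣⟩))
  (isSTO : IsStrictTotalOrder _≡_ (less S (reduct M))) (omin : IsOMinimal S (reduct M))
  (closed⇒elementary : ∀ {B : Pred (Carrier M) ℓ} → IsClosed (reduct M) B → IsElementarySubstructure (reduct M) B)
  (limit : HasLimits M)
  (spanning : ∀ (B : Pred (Carrier M) ℓ) → IsElementarySubstructure (reduct M) B → image 𝔣⟦ M ⟧ B ⊆ B →
    ∀ {n} (c : Vec (Carrier M) n) → Σ[ d ∈ Vec (Carrier M) n ]
      image 𝔣⟦ M ⟧ (⟨ reduct M ⟩ (B ∪ (_∈ᵛ c))) ⊆ ⟨ reduct M ⟩ (image 𝔣⟦ M ⟧ B ∪ (_∈ᵛ d)))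
  (uniform : ∀ {m k n l : ℕ} (f : Term L (m + k)) (g : Term L (n + l)) (n≤m : n ℕ.≤ m) →
    ∀ (a : ℕ → Vec (Carrier M) m) → IsIndiscernible M a →
    (∀ i → All (range 𝔣⟦ M ⟧) (truncate n≤m (a i))) →
    ∀ (b₁ : Vec (Carrier M) k) (b₂ : Vec (Carrier M) l) → All (range 𝔣⟦ M ⟧) b₂ →
    FiniteOrCofinite (λ i → 𝔣⟦ M ⟧ (eval (reduct M) (a i ++ b₁) f) ≡ eval (reduct M) (truncate n≤m (a i) ++ b₂) g))
  where

  open Exchange em S (reduct M) isSTO omin (λ X → closed⇒elementary app)
  open NIP em S (reduct M) isSTO omin (reduct-limits limit)

  private
    C = Carrier M
    Mᴸ = reduct M
    f̂ = 𝔣⟦ M ⟧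

  applied : Vec (Term (L ⟨𝔣⟩) n) k → Vec (Term (L ⟨𝔣⟩) n) k
  applied = map (λ t → app 𝔣 (t ∷ []))

  evals-applied : (v : Vec C n) (ts : Vec (Term (L ⟨𝔣⟩) n) k) → evals M v (applied ts) ≡ map f̂ (evals M v ts)
  evals-applied v []       = refl
  evals-applied v (t ∷ ts) = cong (f̂ (eval M v t) ∷_) (evals-applied v ts)

  all-image : {B : Pred C ℓ} {x : Vec C k} → All (image f̂ B) x → Σ[ y ∈ Vec C k ] All B y × map f̂ y ≡ x
  all-image [] = [] , [] , refl
  all-image ((y , By , refl) ∷ Bx) with ys , Bys , refl ← all-image Bx = y ∷ ys , By ∷ Bys , refl

  image-all : {B : Pred C ℓ} {y : Vec C k} → All B y → All (image f̂ B) (map f̂ y)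
  image-all []        = []
  image-all (By ∷ Bys) = (_ , By , refl) ∷ image-all Bys

  -- Hypothesis (ii) is applied to B = Hull a e.
  Generators : ∀ {p} → (ℕ → Vec C p) → Vec C m → Pred C ℓ
  Generators a e u = (∃[ i ] u ∈ᵛ a i) ⊎ u ∈ᵛ e

  -- Generation takes place in `M` and not in its reduct, which makes the set closed under `𝔣`.
  Hull : ∀ {p} → (ℕ → Vec C p) → Vec C m → Pred C ℓ
  Hull a e = ⟨ M ⟩ (Generators a e)

  hull-closed : ∀ {p} {a : ℕ → Vec C p} {e : Vec C m} → IsClosed Mᴸ (Hull a e)
  hull-closed F = app (old F)

  hull-mono : ∀ {p} {a : ℕ → Vec C p} {x : Vec C k} {e : Vec C m} → Hull a e ⊆ Hull a (x ++ e)
  hull-mono {x = x} = ⟨⟩-mono λ { (inj₁ a) → inj₁ a ; (inj₂ e) → inj₂ (∈-++⁺ʳ x e) }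

  combine : ∀ {n′ r} → Vec (Term (L ⟨𝔣⟩) n) n′ → Term L (n′ + r) → Vec C n → Vec C r → C
  combine h g v d = eval Mᴸ (evals M v (applied h) ++ d) g

  combineᵀ : ∀ {n′ r} (h : Vec (Term (L ⟨𝔣⟩) n) n′) (g : Term L (n′ + r))
    {E : Set ℓ₁} {κ : E → Vec C k} {v : E → Vec C n} {d : E → Vec C r} →
    TermFuns M κ v → TermFuns M κ d → TermFun M κ (λ x → combine h g (v x) (d x))
  combineᵀ h g vᵀ dᵀ = _∘ᵀ_ {κ = id} (embedᵀ (g , λ _ → refl)) (evalsᵀ (applied h) vᵀ ++ᵀ dᵀ)

  module _ {p} {a : ℕ → Vec C p} {e : Vec C m} where

    generators-prefix : ∀ {u} → Generators a e u → Eventually (λ N → u ∈ᵛ prefix N a e)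
    generators-prefix (inj₁ (i , u∈)) = suc i , λ N i<N → prefix-∈ˡ N i<N u∈
    generators-prefix (inj₂ u∈)       = 0 , λ N _ → prefix-∈ʳ N u∈

    combine-∈ : ∀ {n′ r N} (h : Vec (Term (L ⟨𝔣⟩) (p + prefixLength p N m)) n′) (g : Term L (n′ + r)) i (d : Vec C r) →
      ⟨ Mᴸ ⟩ (image f̂ (Hull a e) ∪ (_∈ᵛ d)) (combine h g (a i ++ prefix N a e) d)
    combine-∈ {N = N} h g i d = eval-closed app (All.++⁺
        (subst (All _) (sym (evals-applied _ h)) (All.map (gen ∘ inj₁) (image-all (evals-closed app all-hull h))))
        (All.lookup⁻ λ x → gen (inj₂ (∈-lookup x d)))) g
      where
      all-a : ∀ i → All (Hull a e) (a i)
      all-a i = All.lookup⁻ λ x → gen (inj₁ (i , ∈-lookup x (a i)))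
      all-hull : All (Hull a e) (a i ++ prefix N a e)
      all-hull = All.++⁺ (all-a i) (all-prefix N all-a (All.lookup⁻ λ x → gen (inj₂ (∈-lookup x e))))

    -- Only finitely many `a i` are involved, and they all lie in `prefix N a e` for large N.
    -- Membership thus becomes a single equation, which a limit of the sequence can be made to
    -- avoid.
    ∈-combine : ∀ {r} {x : Vec C p} {d : Vec C r} {u} → ⟨ Mᴸ ⟩ (image f̂ (Hull a (x ++ e)) ∪ (_∈ᵛ d)) u →
      ∃[ N ] ∃[ n′ ] Σ[ h ∈ Vec (Term (L ⟨𝔣⟩) (p + prefixLength p N m)) n′ ] Σ[ g ∈ Term L (n′ + r) ]
        combine h g (x ++ prefix N a e) d ≡ u
    ∈-combine {x = x} {d} u∈ with n′ , w , w∈ , g , refl ← span-term d u∈ with y , y∈ , refl ← all-image w∈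
      with N , h∈ ← ⟨⟩-eventually* {v = λ N → x ++ prefix N a e} (λ where
        (inj₁ u) → let N , u∈ = generators-prefix (inj₁ u) in N , λ i N≤i → ∈-++⁺ʳ x (u∈ i N≤i)
        (inj₂ u∈) → 0 , λ N _ → [ ∈-++⁺ˡ , ∈-++⁺ʳ x ∘ prefix-∈ʳ N ]′ (Any.++⁻ x u∈)) y∈
      with h , refl ← ∈-terms (x ++ prefix N a e) (h∈ N ℕ.≤-refl) =
      N , n′ , h , g , cong (λ w → eval Mᴸ (w ++ d) g) (evals-applied _ h)

  module _ {p q} (a : ℕ → Vec C p) (ind : IsIndiscernible M a) (b : Vec C q) (t : Term L (p + q)) where

    -- The equation 𝔣(f(aᵢ, b)) = g(𝔣(h(aᵢ, y)), d), with fixed g and h, holds for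
    -- infinitely many i; hypothesis (iii) then turns this into almost all i.
    record Captured : Set ℓ where
      field
        {y-length h-length d-length} : ℕ
        start     : ℕ
        y         : Vec C y-length
        over-y    : IndiscernibleOver {M = M} (λ i → a (start + i)) y
        h         : Vec (Term (L ⟨𝔣⟩) (p + y-length)) h-length
        g         : Term L (h-length + d-length)
        d         : Vec C d-length
        d-range   : All (range f̂) d
        recurring : ¬ Eventually (λ i → ¬ f̂ (eval Mᴸ (a i ++ b) t) ≡ combine h g (a i ++ y) d)

    -- `over-e` is carried along because an equation that recurs at a later stage has e among its
    -- parameters, and `Captured` demands indiscernibility over them.
    record Stage (r : ℕ) : Set ℓ where
      field
        {e-length}  : ℕ
        e           : Vec C e-length
        over-e      : IndiscernibleOver {M = M} a e
        d           : Vec C r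
        d-∈         : All (image f̂ (⟨ Mᴸ ⟩ (Hull a e ∪ (_∈ᵛ b)))) d
        independent : Independent (image f̂ (Hull a e)) d

    stage₀ : Stage 0
    stage₀ = record { e = [] ; over-e = indiscernible-over-[] ind ; d = [] ; d-∈ = [] ; independent = tt }

    -- If no such equation recurs, then none holds at a limit x of the sequence, so
    -- that 𝔣(t(x, b)) is a new independent element.
    module _ (uncaptured : ¬ Captured) {r} (stage : Stage r) where
      open Stage stage

      private
        -- The limit is taken over `b` and `d` as well: the inequations that x inherits contain `b`
        -- through t and `d` as constants.
        x = proj₁ (limit a (e ++ (b ++ d)))
        Parameter = Generators a (e ++ (b ++ d))
        x-limit : ∀ {k} {w : Vec C k} → All Parameter w →
                  {Q : Vec C p → Set ℓ} → Definable M (λ x → x ++ w) Q → Eventually (Q ∘ a) → Q x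
        x-limit = proj₂ (limit a (e ++ (b ++ d)))
        e-parameter : ∀ {u} → u ∈ᵛ e → Parameter u
        e-parameter = inj₂ ∘ ∈-++⁺ˡ
        b-parameter : ∀ {u} → u ∈ᵛ b → Parameter u
        b-parameter = inj₂ ∘ ∈-++⁺ʳ e ∘ ∈-++⁺ˡ
        d-parameter : ∀ {u} → u ∈ᵛ d → Parameter u
        d-parameter = inj₂ ∘ ∈-++⁺ʳ e ∘ ∈-++⁺ʳ b

      -- Membership would amount to one equation with parameters from w, c, e and finitely many aᵢ.
      -- It fails at almost all aᵢ, hence at x.
      ∉-limit : ∀ {k l} {w : Vec C k} (c : Vec C l) → All Parameter w → All Parameter c →
        {U : Vec C p → C} → TermFun M (λ x → x ++ w) U →
        (∀ N {n′} h (g : Term L (n′ + l)) → Eventually (λ i → ¬ U (a i) ≡ combine h g (a i ++ prefix N a e) c)) →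
        ¬ ⟨ Mᴸ ⟩ (image f̂ (Hull a (x ++ e)) ∪ (_∈ᵛ c)) (U x)
      ∉-limit {k = k} {w = w} c w-par c-par {U} Uᵀ never U∈ with N , _ , h , g , eq ← ∈-combine U∈ =
        x-limit {w = w ++ (prefix N a e ++ c)}
          (All.++⁺ w-par (All.++⁺ (all-prefix N (λ i → All.lookup⁻ λ j → inj₁ (i , ∈-lookup j (a i)))
            (All.lookup⁻ λ j → e-parameter (∈-lookup j e))) c-par))
          (¬ᴰ ((Uᵀ ∘ᵀ (xᵀ ++ᵀ wᵀ)) ≡ᴰ combineᵀ h g (xᵀ ++ᵀ yᵀ) cᵀ)) (never N h g) (sym eq)
        where
        y = prefix N a e
        κ : Vec C p → Vec C _
        κ x = x ++ (w ++ (y ++ c))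
        xᵀ : TermFuns M κ id
        xᵀ = ++⁻ˡ p idᵀ
        wycᵀ : TermFuns M κ (λ _ → w ++ (y ++ c))
        wycᵀ = ++⁻ʳ p {f = id} idᵀ
        wᵀ : TermFuns M κ (λ _ → w)
        wᵀ = ++⁻ˡ k wycᵀ
        ycᵀ : TermFuns M κ (λ _ → y ++ c)
        ycᵀ = ++⁻ʳ k {f = λ _ → w} wycᵀ
        yᵀ : TermFuns M κ (λ _ → y)
        yᵀ = ++⁻ˡ _ ycᵀ
        cᵀ : TermFuns M κ (λ _ → c)
        cᵀ = ++⁻ʳ _ {f = λ _ → y} ycᵀ

      -- `∉-limit` is used with a constant `U`: with aᵢ in place of x the hull does not grow, so the
      -- equation fails for every i.
      independent-limit : ∀ {l} (c : Vec C l) → All Parameter c → Independent (image f̂ (Hull a e)) c →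
                          Independent (image f̂ (Hull a (x ++ e))) c
      independent-limit [] _ _ = tt
      independent-limit (u ∷ c) (u-par ∷ c-par) (u∉ , indep) =
        ∉-limit {w = u ∷ []} c (u-par ∷ []) c-par {U = λ _ → u} (headᵀ (++⁻ʳ p {f = id} idᵀ))
          (λ N h g → 0 , λ i _ eq → u∉ (subst (⟨ Mᴸ ⟩ _) (sym eq) (combine-∈ {N = N} h g i c))) ,
        independent-limit c c-par indep

      next-stage : Stage (suc r)
      next-stage = record
        { e           = x ++ e
        ; over-e      = indiscernible-limit (λ w-par → x-limit (All.map (λ where
            (inj₁ a) → inj₁ a
            (inj₂ e) → e-parameter e) w-par)) over-e
        ; d           = f̂ (eval Mᴸ (x ++ b) t) ∷ d
        ; d-∈         = (_ , eval-closed {A = Mᴸ} {B = ⟨ Mᴸ ⟩ (Hull a (x ++ e) ∪ (_∈ᵛ b))} app (All.++⁺ {xs = x} {ys = b}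
            (All.lookup⁻ λ j → gen (inj₁ (gen (inj₂ (∈-++⁺ˡ (∈-lookup j x))))))
            (All.lookup⁻ λ j → gen (inj₂ (∈-lookup j b)))) t , refl)
            ∷ All.map (λ (z , z∈ , eq) → z , ⟨⟩-mono (λ where
              (inj₁ z) → inj₁ (hull-mono {x = x} z)
              (inj₂ z) → inj₂ z) z∈ , eq) d-∈
        ; independent =
            ∉-limit {w = b} d (All.lookup⁻ λ j → b-parameter (∈-lookup j b)) d-par
              {U = λ x → f̂ (eval Mᴸ (x ++ b) t)} (funᵀ 𝔣 (embedᵀ (evalᵀ t idᵀ) ∷ᵀ []ᵀ))
              -- An equation that does not eventually fail would be captured, with the first N terms
              -- of the sequence moved into y.
              (λ N h g → ¬¬-elim {A = M} em λ recurring → uncaptured record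
                { start = N ; y = prefix N a e ; over-y = indiscernible-prefix N over-e
                ; h = h ; g = g ; d = d ; d-range = All.map (λ (z , _ , eq) → z , eq) d-∈
                ; recurring = recurring })
            , independent-limit d d-par independent
        }
        where
        d-par : All Parameter d
        d-par = All.lookup⁻ λ j → d-parameter (∈-lookup j d)

    stages : ¬ Captured → ∀ r → Stage r
    stages uncaptured zero    = stage₀
    stages uncaptured (suc r) = next-stage uncaptured (stages uncaptured r)

    captured : Captured
    captured = ¬¬-elim {A = M} em λ uncaptured → let
        open Stage (stages uncaptured (suc q))
        d′ , spans = spanning (Hull a e) (closed⇒elementary hull-closed) (λ { (_ , z , refl) → app 𝔣 (z ∷ []) }) b
      in ℕ.<-irrefl refl (independent⇒≤ d′ d independent (All.map spans d-∈))

  -- The invariant for removing `𝔣` from formulas. The sequence keeps the indexing of v, so that the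
  -- equations match term by term, and only its tail has to be indiscernible.
  record Tame (v : ℕ → Vec C n) : Set ℓ where
    field
      {p q}    : ℕ
      start    : ℕ
      a        : ℕ → Vec C p
      a-ind    : IsIndiscernible M (λ i → a (start + i))
      b        : Vec C q
      us       : Vec (Term L (p + q)) n
      us≡      : Eventually (λ i → evals Mᴸ (a i ++ b) us ≡ v i)

  tame-map : {v : ℕ → Vec C n} {w : ℕ → Vec C k} → TermFuns Mᴸ v w → Tame v → Tame w
  tame-map (ts , ts≡) tame = record
    { a-ind = a-ind ; b = b ; us = ts ⟪ us ⟫*
    ; us≡ = proj₁ us≡ , λ i h → trans (evals-⟪⟫* Mᴸ (a i ++ b) us ts)
        (trans (cong (λ w → evals Mᴸ w ts) (proj₂ us≡ i h)) (ts≡ i)) }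
    where open Tame tame

  truncate-++ : ∀ {n} (xs : Vec C n) {ys : Vec C k} → truncate (ℕ.m≤m+n n k) (xs ++ ys) ≡ xs
  truncate-++ []       = refl
  truncate-++ (x ∷ xs) = cong (x ∷_) (truncate-++ xs)

  module _ {v : ℕ → Vec C (suc n)} (tame : Tame v)
    (capture : Captured (λ i → Tame.a tame (Tame.start tame + i)) (Tame.a-ind tame) (Tame.b tame) (head (Tame.us tame)))
    where

    open Tame tame
    private
      module K = Captured capture
      h = K.h-length

      head-evals : ∀ {m n} (v : Vec C m) (us : Vec (Term L m) (suc n)) → head (evals Mᴸ v us) ≡ eval Mᴸ v (head us)
      head-evals v (_ ∷ _) = refl
      tail-evals : ∀ {m n} (v : Vec C m) (us : Vec (Term L m) (suc n)) → tail (evals Mᴸ v us) ≡ evals Mᴸ v (tail us)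
      tail-evals v (_ ∷ _) = refl

      hs : ℕ → Vec C h
      hs i = evals M (a i ++ K.y) (applied K.h)

      -- The `𝔣`-values come first, since (iii) lets g use only an initial segment lying in the
      -- range of `𝔣`.
      a′ : ℕ → Vec C (h + p)
      a′ i = hs i ++ a i

      a′-ind : IsIndiscernible M (λ i → a′ (start + (K.start + i)))
      a′-ind = indiscernible-image (evalsᵀ (applied K.h) idᵀ ++ᵀ ++⁻ˡ p {f = id} {g = λ _ → K.y} idᵀ) K.over-y

      fᵀ : TermFun Mᴸ {E = Vec C h × Vec C p × Vec C q} (λ (u , x , b) → (u ++ x) ++ b) (λ (u , x , b) → eval Mᴸ (x ++ b) (head us))
      fᵀ = evalᵀ (head us) (++⁻ʳ h {f = proj₁} ux ++ᵀ ++⁻ʳ (h + p) {f = λ (u , x , b) → u ++ x} idᵀ)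
        where
        ux : TermFuns Mᴸ (λ ((u , x , b) : Vec C h × Vec C p × Vec C q) → (u ++ x) ++ b) (λ (u , x , b) → u ++ x)
        ux = ++⁻ˡ (h + p) idᵀ

      usᵀ : TermFuns Mᴸ (λ i → a′ i ++ (b ++ K.d)) (λ i → eval Mᴸ (hs i ++ K.d) K.g ∷ evals Mᴸ (a i ++ b) (tail us))
      usᵀ = evalᵀ K.g (++⁻ˡ h a′ᵀ ++ᵀ ++⁻ʳ q {f = λ _ → b} bd) ∷ᵀ
            evalsᵀ (tail us) (++⁻ʳ h {f = hs} a′ᵀ ++ᵀ ++⁻ˡ q bd)
        where
        a′ᵀ : TermFuns Mᴸ (λ i → a′ i ++ (b ++ K.d)) (λ i → hs i ++ a i)
        a′ᵀ = ++⁻ˡ (h + p) idᵀ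
        bd : TermFuns Mᴸ (λ i → a′ i ++ (b ++ K.d)) (λ _ → b ++ K.d)
        bd = ++⁻ʳ (h + p) {f = a′} idᵀ

      all-range : ∀ {m k} (v : Vec C m) (ts : Vec (Term (L ⟨𝔣⟩) m) k) → All (range f̂) (evals M v (applied ts))
      all-range v []       = []
      all-range v (t ∷ ts) = (_ , refl) ∷ all-range v ts

      G : ℕ → Set ℓ
      G i = f̂ (eval Mᴸ (a i ++ b) (head us)) ≡ eval Mᴸ (hs i ++ K.d) K.g

      s : ℕ → ℕ
      s i = start + (K.start + i)

      fin-or-cofin : FiniteOrCofinite (λ i → f̂ (eval Mᴸ (a′ (s i) ++ b) (term fᵀ))
        ≡ eval Mᴸ (truncate (ℕ.m≤m+n h p) (a′ (s i)) ++ K.d) K.g)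
      fin-or-cofin = uniform (term fᵀ) K.g (ℕ.m≤m+n h p) (λ i → a′ (s i)) a′-ind
        (λ i → subst (All _) (sym (truncate-++ (hs (s i)))) (all-range _ K.h)) b K.d K.d-range

      same : ∀ i → (f̂ (eval Mᴸ (a′ (s i) ++ b) (term fᵀ))
        ≡ eval Mᴸ (truncate (ℕ.m≤m+n h p) (a′ (s i)) ++ K.d) K.g) ≡ G (s i)
      same i = cong₂ (λ x u → f̂ x ≡ eval Mᴸ (u ++ K.d) K.g) (eval-term fᵀ (hs (s i) , a (s i) , b)) (truncate-++ (hs (s i)))

      eventually-g : Eventually G
      eventually-g with fin-or-cofin
      -- Finitely many solutions contradict recurrence, which leaves the cofinite case.
      ... | inj₁ (N , never) = flip contradiction K.recurring
        (K.start + N , λ i N≤i eq → let o , o≡i = ℕ.m≤n⇒∃[o]m+o≡n N≤i in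
          never (N + o) (ℕ.m≤m+n N o) (subst id (sym (same (N + o)))
            (subst (G ∘ (start +_)) (trans (sym o≡i) (ℕ.+-assoc K.start N o)) eq)))
      ... | inj₂ (N , ¬¬always) = start + (K.start + N) , λ i N≤i → let o , o≡i = ℕ.m≤n⇒∃[o]m+o≡n N≤i in
        subst G (trans (sym (trans (ℕ.+-assoc start (K.start + N) o) (cong (start +_) (ℕ.+-assoc K.start N o)))) o≡i)
          (subst id (same (N + o)) (¬¬-elim {A = M} em (¬¬always (N + o) (ℕ.m≤m+n N o))))

    tame-captured : Tame (λ i → f̂ (head (v i)) ∷ tail (v i))
    tame-captured = record
      { start = start + K.start
      ; a     = a′
      ; a-ind = indiscernible-cong (λ i → cong a′ (sym (ℕ.+-assoc start K.start i))) a′-ind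
      ; b     = b ++ K.d
      ; us    = terms usᵀ
      ; us≡   = let N , h = eventually-× us≡ eventually-g in N , λ i N≤i → let us≡v , g≡ = h i N≤i in
          trans (evals-terms usᵀ i) (cong₂ _∷_
            (trans (sym g≡) (cong f̂ (trans (sym (head-evals (a i ++ b) us)) (cong head us≡v))))
            (trans (sym (tail-evals (a i ++ b) us)) (cong tail us≡v)))
      }

  tame-𝔣 : {v : ℕ → Vec C (suc n)} → Tame v → Tame (λ i → f̂ (head (v i)) ∷ tail (v i))
  tame-𝔣 tame = tame-captured tame (captured (λ i → a (start + i)) a-ind b (head us))
    where open Tame tame

  -- The tuple u is carried along because each removal of `𝔣` changes the indiscernible sequence,
  -- and the variables of the remaining terms must be expressed in the new one.
  tame-eval  : {u : ℕ → Vec C m} {v : ℕ → Vec C n} (t : Term (L ⟨𝔣⟩) n) →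
    Tame u → TermFuns Mᴸ u v → Tame (λ i → eval M (v i) t ∷ u i)
  tame-evals : {u : ℕ → Vec C m} {v : ℕ → Vec C n} (ts : Vec (Term (L ⟨𝔣⟩) n) k) →
    Tame u → TermFuns Mᴸ u v → Tame (λ i → evals M (v i) ts ++ u i)
  tame-eval (var j) tame vᵀ = tame-map (evalᵀ (var j) vᵀ ∷ᵀ idᵀ) tame
  tame-eval {u = u} {v} (app {k} (old F) ts) tame vᵀ =
    tame-map (funᵀ F (++⁻ˡ k idᵀ) ∷ᵀ ++⁻ʳ k {f = λ i → evals M (v i) ts} idᵀ) (tame-evals ts tame vᵀ)
  tame-eval (app 𝔣 (t ∷ [])) tame vᵀ = tame-𝔣 (tame-eval t tame vᵀ)
  tame-evals [] tame vᵀ = tame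
  tame-evals {k = suc k} {v = v} (t ∷ ts) tame vᵀ = tame-eval t (tame-evals ts tame vᵀ)
    (_∘ᵀˢ_ {g = id} vᵀ (++⁻ʳ k {f = λ i → evals M (v i) ts} idᵀ))

  Settled : (ℕ → Set ℓ) → Set ℓ
  Settled P = Eventually P ⊎ Eventually (λ i → ¬ P i)

  -- After substituting the terms `us`, this is a formula without `𝔣` in one block of the sequence
  -- and the constants `b`, so o-minimality decides it through `indiscernible-++` with k = 1.
  tame-settled : {v : ℕ → Vec C n} {P : ℕ → Set ℓ} → Tame v → Definable Mᴸ v P → Settled P
  tame-settled {n} {v} {P} tame Pᴰ = settle (indiscernible-++ b eventually-ind 1 (formula φᴰ))
    where
    open Tame tame
    α : ℕ → Vec C p
    α i = a (start + i)
    eventually-ind : EventuallyIndiscernible Mᴸ α []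
    eventually-ind k φ with indiscernible-eventually em (indiscernible-over-[] a-ind) k (embedF φ)
    ... | N , inj₁ always = N , inj₁ λ is h → to (⊨-embedF φ _) (always is h)
    ... | N , inj₂ never  = N , inj₂ λ is h → never is h ∘ from (⊨-embedF φ _)
    φᴰ : Definable Mᴸ (λ i → blocks α (i ∷ []) ++ b) (λ i → Mᴸ ⊨ formula Pᴰ [ evals Mᴸ (α i ++ b) us ])
    φᴰ = ⊨ᴰ (formula Pᴰ) (evalsᵀ us (++⁻ˡ p (++⁻ˡ (1 * p) idᵀ) ++ᵀ ++⁻ʳ (1 * p) {f = λ i → blocks α (i ∷ [])} idᵀ))

    φ⇔P : ∀ i → proj₁ us≡ ℕ.≤ start + i → Mᴸ ⊨ formula φᴰ [ blocks α (i ∷ []) ++ b ] ⇔ P (start + i)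
    φ⇔P i h = ⇔.trans (⊨-formula φᴰ i)
      (subst (λ w → Mᴸ ⊨ formula Pᴰ [ w ] ⇔ P (start + i)) (sym (proj₂ us≡ _ h)) (⊨-formula Pᴰ (start + i)))

    shifted : ∀ N (Q : ℕ → Set ℓ) → (∀ i → N ℕ.< i → proj₁ us≡ ℕ.≤ start + i → Q (start + i)) → Eventually Q
    shifted N Q h = start + suc (N ℕ.⊔ proj₁ us≡) , λ i ≤i → let o , o≡i = ℕ.m≤n⇒∃[o]m+o≡n ≤i in
      subst Q (trans (sym (ℕ.+-assoc start _ o)) o≡i) (h (suc (N ℕ.⊔ proj₁ us≡) + o)
        (ℕ.s≤s (ℕ.≤-trans (ℕ.m≤m⊔n N _) (ℕ.m≤m+n _ o)))
        (ℕ.≤-trans (ℕ.m≤n⊔m N _) (ℕ.≤-trans (ℕ.m≤m+n _ o) (ℕ.≤-trans (ℕ.n≤1+n _) (ℕ.m≤n+m _ start)))))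

    settle : EventuallyConstant (λ is → Mᴸ ⊨ formula φᴰ [ blocks α is ++ b ]) → Settled P
    settle (N , inj₁ always) = inj₁ (shifted N P λ i N<i h → to (φ⇔P i h) (always (i ∷ []) (N<i ∷ [-])))
    settle (N , inj₂ never)  = inj₂ (shifted N (λ i → ¬ P i) λ i N<i h Pi →
      never (i ∷ []) (N<i ∷ [-]) (from (φ⇔P i h) Pi))

  quantifierFree-settled : {v : ℕ → Vec C n} {φ : Formula (L ⟨𝔣⟩) n} → QuantifierFree φ → Tame v →
                           Settled (λ i → M ⊨ φ [ v i ])
  quantifierFree-settled (s ≐ t) tame =
    tame-settled (tame-evals (s ∷ t ∷ []) tame idᵀ) (headᵀ idᵀ ≡ᴰ headᵀ (tailᵀ idᵀ))
  quantifierFree-settled (rel {k} R ts) tame =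
    tame-settled (tame-evals ts tame idᵀ) (relᴰ R (++⁻ˡ k idᵀ))
  quantifierFree-settled ⊥̇ tame = inj₂ (0 , λ _ _ → Lift.lower)
  quantifierFree-settled (φ ⇒ ψ) tame
    with quantifierFree-settled φ tame | quantifierFree-settled ψ tame
  ... | _                  | inj₁ (N , ψ-true)  = inj₁ (N , λ i h _ → ψ-true i h)
  ... | inj₂ (N , φ-false) | inj₂ _             = inj₁ (N , λ i h φi → contradiction φi (φ-false i h))
  ... | inj₁ φ-true        | inj₂ ψ-false with N , h ← eventually-× φ-true ψ-false =
    inj₂ (N , λ i N≤i φ⇒ψ → proj₂ (h i N≤i) (φ⇒ψ (proj₁ (h i N≤i))))

  tame-++ : ∀ {p q} {a : ℕ → Vec C p} → IsIndiscernible M a → (b : Vec C q) → Tame (λ i → a i ++ b)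
  tame-++ {a = a} ind b = record
    { start = 0 ; a = a ; a-ind = ind ; b = b ; us = terms ab ; us≡ = 0 , λ i _ → evals-terms ab i }
    where
    ab : TermFuns Mᴸ (λ i → a i ++ b) (λ i → a i ++ b)
    ab = idᵀ

  dependent : (∀ {n} (φ : Formula (L ⟨𝔣⟩) n) →
      ∃[ ψ ] QuantifierFree ψ × (∀ v → M ⊨ φ [ v ] ⇔ M ⊨ ψ [ v ])) → IsDependent M
  dependent qe φ a ind b with ψ , ψ-qf , φ⇔ψ ← qe φ with quantifierFree-settled ψ-qf (tame-++ ind b)
  ... | inj₁ (N , always) = N , inj₁ λ i N<i → from (φ⇔ψ _) (always i (ℕ.<⇒≤ N<i))
  ... | inj₂ (N , never)  = N , inj₂ λ i N<i φi → lift (never i (ℕ.<⇒≤ N<i) (to (φ⇔ψ _) φi))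

open import Data.Nat.Base using (_≤_)

theorem4p1 :
  Classical →
  ∀ {ℓ : Level} (L : Language ℓ) (S : HasOrderedGroupSymbols L) (T : Theory L) →
  IsComplete T →
  ExtendsOrderedAbelianGroups S T →
  IsOMinimalTheory S T →
  HasQE T →
  HasUniversalAxiomatization T →
  ∀ (T𝔣 : Theory (L ⟨𝔣⟩)) →
  IsComplete T𝔣 →
  Extends T𝔣 T →
  ∀ (M : Structure (L ⟨𝔣⟩)) →
  IsMonsterModel T𝔣 M →
  -- (i)
  HasQE T𝔣 →
  -- (ii)
  (∀ (A : Structure (L ⟨𝔣⟩)) → A isModelOf T𝔣 →
   ∀ (B : Pred (Carrier A) ℓ) → IsElementarySubstructure (reduct A) B →
   image 𝔣⟦ A ⟧ B ⊆ B →
   ∀ {n} (c : Vec (Carrier A) n) →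
   Σ[ d ∈ Vec (Carrier A) n ]
     image 𝔣⟦ A ⟧ (⟨_⟩ (reduct A) (B ∪ (_∈ᵛ c)))
       ⊆ ⟨_⟩ (reduct A) (image 𝔣⟦ A ⟧ B ∪ (_∈ᵛ d))) →
  -- (iii)
  (∀ {m k n l : ℕ} (f : Term L (m + k)) (g : Term L (n + l)) (n≤m : n ≤ m) →
   ∀ (a : ℕ → Vec (Carrier M) m) → IsIndiscernible M a →
   (∀ i → All (range 𝔣⟦ M ⟧) (truncate n≤m (a i))) →
   ∀ (b₁ : Vec (Carrier M) k) (b₂ : Vec (Carrier M) l) → All (range 𝔣⟦ M ⟧) b₂ →
   FiniteOrCofinite (λ i →
     𝔣⟦ M ⟧ (eval (reduct M) (a i ++ b₁) f)
       ≡ eval (reduct M) (truncate n≤m (a i) ++ b₂) g)) →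
  IsDependent M
theorem4p1 em L S T _ ordered o-minimal qe universal T𝔣 _ extends M monster qe𝔣 spanning uniform =
  dependent λ φ → let ψ , ψ-qf , φ⇔ψ = qe𝔣 φ in ψ , ψ-qf , φ⇔ψ M isModel
  where
  open IsMonsterModel monster
  Mᴸ⊨T : reduct M isModelOf T
  Mᴸ⊨T = extends M isModel
  open Main em S M
    (IsOrderedAbelianGroup.isStrictTotalOrder (ordered (reduct M) Mᴸ⊨T)) (o-minimal (reduct M) Mᴸ⊨T)
    (λ cl → closed-elementary cl T qe universal Mᴸ⊨T)
    (Saturation.limit em M κ κ-large saturated) (spanning M isModel) uniform
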